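{- Let $s,t\ge1$ be coprime integers, let $k=\frac12(s+1)(t-1)$, and let $\lambda$ be an $s$-core with $t$-core $\lambda^t$. For $j\in\mathbb{Z}/t\mathbb{Z}$ define $$z_{t,j}(\lambda^t)=\frac1t\bigl(a_{t,sj+k}(\lambda^t)-[a_{t,s(j+1)+k}(\lambda^t)-s]\bigr).$$ Then $$z_{t,j}(\lambda^t)=\bigl|[\mathcal{S}_s(\lambda)-s]\cap(sj+k+t\mathbb{Z})\bigr|\qquad\text{for all } j\in\mathbb{Z}/t\mathbb{Z},$$ and $$|\mathrm{Stab}_{G_{s,t}}(\lambda)|=\prod_{j\in\mathbb{Z}/t\mathbb{Z}}\left(\frac{a_{t,j}(\lambda^t)-[a_{t,j+s}(\lambda^t)-s]}{t}\right)!=\prod_{j\in\mathbb{Z}/t\mathbb{Z}}z_{t,j}(\lambda^t)!.$$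
   Context: A partition is an infinite weakly decreasing sequence $\lambda=(\lambda_1,\lambda_2,\ldots)$ of nonnegative integers with finite sum. Its Young diagram is $[\lambda]=\{(r,c)\in\mathbb{Z}_{>0}^2 : c\le\lambda_r\}$, its conjugate $\overline{\lambda}$ is given by $\overline{\lambda}_r=\#\{c\in\mathbb{Z}_{>0}: r\le\lambda_c\}$. The rim hook of $(r,c)\in[\lambda]$ is $\{(i,j)\in[\lambda]: i\ge r,\ j\ge c,\ (i+1,j+1)\notin[\lambda]\}$, of length $1+(\lambda_r-r)+(\overline{\lambda}_c-c)$; removing it leaves the Young diagram of a smaller partition. A partition is an $s$-core if it has no rim hook of length $s$; $\mathcal{C}_s$ is the set of $s$-cores. For any partition $\lambda$ and $t\ge1$, repeatedly removing rim hooks of length $t$ until none remains yields a $t$-core, independent of the choices made, denoted $\lambda^t$; if $\lambda\in\mathcal{C}_s$ then $\lambda^t\in\mathcal{C}_s\cap\mathcal{C}_t$. The beta-set of $\lambda$ is $B^\lambda=\{\lambda_i-i: i\ge1\}\subset\mathbb{Z}$. For an $s$-core $\lambda$ and $i\in\mathbb{Z}$ (only $i$ mod $s$ matters) put $a_{s,i}(\lambda)=s+\max[B^\lambda\cap(i+s\mathbb{Z})]$, and $\mathcal{S}_s(\lambda)=\{a_{s,i}(\lambda)\}_{i\in\mathbb{Z}/s\mathbb{Z}}=(B^\lambda+s)\setminus B^\lambda$ (the $s$-set). The same notation is used with $t$ in place of $s$ for $t$-cores. The map $\lambda\mapsto\mathcal{S}_s(\lambda)$ is a bijection from $\mathcal{C}_s$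 to the collection of all sets of $s$ integers pairwise incongruent modulo $s$ with sum $\binom{s}{2}$. $G_{s,t}$ is the group (under composition) of permutations $f:\mathbb{Z}\to\mathbb{Z}$ such that $f(m+s)=f(m)+s$ for all $m$; $\sum_{i=0}^{s-1}f(i)=\binom{s}{2}$; and $f(m)\equiv m\pmod t$ for all $m$. It acts on $\mathcal{C}_s$ by letting $f\lambda$ be the $s$-core with $\mathcal{S}_s(f\lambda)=f(\mathcal{S}_s(\lambda))$. -}

module Defs where

import Algebra.Properties.CommutativeMonoid.Sum as CommutativeMonoidSum
open import Data.Fin.Base using (Fin; toℕ)
open import Data.Integer.Base as ℤ using (ℤ; +_)
open import Data.Integer.DivMod using (_%ℕ_; _/ℕ_; a≡a%ℕn+[a/ℕn]*n)
open import Data.Integer.Divisibility.Signed using (_∣_; _∣?_; divides)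
import Data.Integer.Properties as ℤ
open import Data.Integer.Tactic.RingSolver using (solve-∀)
open import Data.List.Base using (applyUpTo; filter; length; upTo)
open import Data.Nat.Base as ℕ using (ℕ; zero; suc; NonZero; _≤_; _<_; z≤n; s≤s; z<s; s<s; _!)
open import Data.Nat.Combinatorics using (_C_)
open import Data.Nat.ListAction using (sum)
import Data.Nat.Properties as ℕ
open import Data.Product.Base using (∃; _×_; _,_; proj₁; proj₂)
open import Data.Rational.Base as ℚ using (ℚ; mkℚ)
open import Function.Base using (_∘_)
open import Function.Bundles using (Bijection; _⇔_)
open import Function.Definitions using (Bijective)
open import Level using (0ℓ)
open import Relation.Binary.Bundles using (Setoid)
import Relation.Binary.Construct.On as On
open import Relation.Binary.Construct.Closure.ReflexiveTransitive using (Star)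
open import Relation.Binary.PropositionalEquality
  using (_≡_; _≢_; refl; sym; trans; cong; subst; setoid; _→-setoid_)
open import Relation.Nullary using (¬_; yes; no; contradiction)
open import Relation.Unary using (Pred; Decidable)

------------------------------------------------------------------------
-- Generalities

-- P, as a subset of S up to the equality of S, has exactly n elements.
HasCardinality : ∀ {a ℓ p} (S : Setoid a ℓ) → Pred (Setoid.Carrier S) p → ℕ → Set _
HasCardinality S P n =
  Bijection (setoid (Fin n)) (On.setoid S (proj₁ {B = P}))

infix 4 _≡_[mod_]
_≡_[mod_] : ℤ → ℤ → ℕ → Set
x ≡ y [mod n ] = + n ∣ x ℤ.- y

IsMaximum : Pred ℤ 0ℓ → ℤ → Set
IsMaximum P m = P m × (∀ x → P x → x ℤ.≤ m)

∑ℤ : ∀ {n} → (Fin n → ℤ) → ℤ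
∑ℤ = CommutativeMonoidSum.sum ℤ.+-0-commutativeMonoid

∏ℕ : ∀ {n} → (Fin n → ℕ) → ℕ
∏ℕ = CommutativeMonoidSum.sum ℕ.*-1-commutativeMonoid

-- Rationals that are not natural numbers get the value 0, which is not the
-- factorial of anything.
infix 8 _!ᵠ
_!ᵠ : ℚ → ℕ
mkℚ (+ n) 0 _ !ᵠ = n !
_             !ᵠ = 0

------------------------------------------------------------------------
-- Partitions.  Rows and columns are numbered from 0, so that part i is
-- the (i+1)-st part; the finiteness of the sum is expressed by a bound on
-- all partial sums.

record Partition : Set where
  field
    part       : ℕ → ℕ
    decreasing : ∀ i → part (suc i) ≤ part i
    bound      : ℕ
    bounded    : ∀ n → sum (applyUpTo part n) ≤ bound
open Partition public

Cell : Set
Cell = ℕ × ℕ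

infix 4 _∈[_]
_∈[_] : Cell → Partition → Set
(r , c) ∈[ ν ] = c < part ν r

-- Rows from number bound ν onwards are empty (part≡0 below), so it is
-- enough to count among the earlier ones.
conjugate : Partition → ℕ → ℕ
conjugate ν c = length (filter (λ r → c ℕ.<? part ν r) (upTo (bound ν)))

RimHook : Partition → Cell → Pred Cell 0ℓ
RimHook ν (r , c) (i , j) =
  (i , j) ∈[ ν ] × r ≤ i × c ≤ j × ¬ (suc i , suc j) ∈[ ν ]

hookLength : Partition → Cell → ℤ
hookLength ν (r , c) =
  + 1 ℤ.+ (+ part ν r ℤ.- + suc r) ℤ.+ (+ conjugate ν c ℤ.- + suc c)

-- μ is obtained from ν by removing one rim hook of length t.
RemoveHook : ℕ → Partition → Partition → Set
RemoveHook t ν μ = ∃ λ x →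
  x ∈[ ν ] × hookLength ν x ≡ + t ×
  (∀ y → y ∈[ μ ] ⇔ (y ∈[ ν ] × ¬ RimHook ν x y))

IsCore : ℕ → Partition → Set
IsCore s ν = ∀ x → x ∈[ ν ] → hookLength ν x ≢ + s

-- κ is the t-core of ν.
IsCoreOf : ℕ → Partition → Partition → Set
IsCoreOf t ν κ = Star (RemoveHook t) ν κ × IsCore t κ

------------------------------------------------------------------------
-- Beta-sets

beta : Partition → ℕ → ℤ
beta ν i = + part ν i ℤ.- + suc i

BetaSet : Partition → Pred ℤ 0ℓ
BetaSet ν b = ∃ λ i → b ≡ beta ν i

private
  n≤sum : ∀ n f → (∀ i → i < n → 1 ≤ f i) → n ≤ sum (applyUpTo f n)
  n≤sum zero    f h = z≤n
  n≤sum (suc n) f h = ℕ.+-mono-≤ (h 0 z<s) (n≤sum n (f ∘ suc) λ i i<n → h (suc i) (s<s i<n))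

  antitone : ∀ ν i d → part ν (d ℕ.+ i) ≤ part ν i
  antitone ν i zero    = ℕ.≤-refl
  antitone ν i (suc d) = ℕ.≤-trans (decreasing ν (d ℕ.+ i)) (antitone ν i d)

part-mono : ∀ ν {i j} → i ≤ j → part ν j ≤ part ν i
part-mono ν {i} {j} i≤j = subst (λ n → part ν n ≤ part ν i) (ℕ.m∸n+n≡m i≤j) (antitone ν i (j ℕ.∸ i))

part≡0 : ∀ ν {i} → bound ν ≤ i → part ν i ≡ 0
part≡0 ν {i} b≤i with part ν i in eq
... | zero  = refl
... | suc p = contradiction
  (ℕ.≤-trans (n≤sum (suc i) (part ν) positive) (bounded ν (suc i))) (ℕ.≤⇒≯ b≤i)
  where
  positive : ∀ j → j < suc i → 1 ≤ part ν j
  positive j (s≤s j≤i) = ℕ.≤-trans (subst (1 ≤_) (sym eq) (s≤s z≤n)) (part-mono ν j≤i)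

beta-mono : ∀ ν {i j} → i ≤ j → beta ν j ℤ.≤ beta ν i
beta-mono ν i≤j = ℤ.+-mono-≤ (ℤ.+≤+ (part-mono ν i≤j)) (ℤ.neg-mono-≤ (ℤ.+≤+ (s≤s i≤j)))

private
  least : ∀ {P : Pred ℕ 0ℓ} → Decidable P → ∀ n → P n → ∃ λ m → P m × (∀ k → P k → m ≤ k)
  least P? n pn with P? 0
  least P? n       pn | yes p0 = 0 , p0 , λ _ _ → z≤n
  least P? zero    pn | no ¬p0 = contradiction pn ¬p0
  least P? (suc n) pn | no ¬p0 with least (P? ∘ suc) n pn
  ... | m , pm , min = suc m , pm , λ { zero p → contradiction p ¬p0 ; (suc k) p → s≤s (min k p) }

  rearrange : ∀ i r q s b → ℤ.- i ≡ r ℤ.+ q ℤ.* s →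
              ℤ.- (r ℤ.+ s ℤ.* b) ℤ.- i ≡ (q ℤ.- b) ℤ.* s
  rearrange i r q s b eq = trans (cong (λ n → ℤ.- (r ℤ.+ s ℤ.* b) ℤ.+ n) eq) (identity r q s b)
    where
    identity : ∀ r q s b → ℤ.- (r ℤ.+ s ℤ.* b) ℤ.+ (r ℤ.+ q ℤ.* s) ≡ (q ℤ.- b) ℤ.* s
    identity = solve-∀

  beta-hits : ∀ ν s .{{_ : NonZero s}} i → ∃ λ n → beta ν n ≡ i [mod s ]
  beta-hits ν s@(suc s′) i = n , divides (q ℤ.- + suc b) (trans (cong (ℤ._- i) beta-n)
      (rearrange i (+ r) q (+ s) (+ suc b) (a≡a%ℕn+[a/ℕn]*n (ℤ.- i) s)))
    where
    b = bound ν
    r = (ℤ.- i) %ℕ s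
    q = (ℤ.- i) /ℕ s
    n = r ℕ.+ (b ℕ.+ s′ ℕ.* suc b)
    b≤n : b ≤ n
    b≤n = ℕ.≤-trans (ℕ.m≤m+n b _) (ℕ.m≤n+m _ r)
    beta-n : beta ν n ≡ ℤ.- (+ r ℤ.+ + s ℤ.* + suc b)
    beta-n = trans (cong (λ p → + p ℤ.- + suc n) (part≡0 ν b≤n))
      (trans (ℤ.+-identityˡ _) (cong ℤ.-_ (cong +_ (sym (ℕ.+-suc r _)))))

maxBeta : ∀ ν s .{{_ : NonZero s}} i →
          ∃ (IsMaximum λ b → BetaSet ν b × b ≡ i [mod s ])
maxBeta ν s i with beta-hits ν s i
... | n , hit with least (λ m → + s ∣? (beta ν m ℤ.- i)) n hit
... | m , pm , min = beta ν m , ((m , refl) , pm) ,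
  λ { _ ((k , refl) , pk) → beta-mono ν (min k pk) }

a : (s : ℕ) .{{_ : NonZero s}} → ℤ → Partition → ℤ
a s i ν = + s ℤ.+ proj₁ (maxBeta ν s i)

-- The set of all a s i ν; i ranges over ℤ, but only its class mod s matters.
𝒮 : (s : ℕ) .{{_ : NonZero s}} → Partition → Pred ℤ 0ℓ
𝒮 s ν x = ∃ λ i → x ≡ a s i ν

-- For s and t coprime the product is even, so the division is exact.
k : ℕ → ℕ → ℕ
k s t = ((s ℕ.+ 1) ℕ.* (t ℕ.∸ 1)) ℕ./ 2

z : (s t : ℕ) .{{_ : NonZero t}} → ℤ → Partition → ℚ
z s t j κ =
  (a t (+ s ℤ.* j ℤ.+ + k s t) κ
    ℤ.- (a t (+ s ℤ.* (j ℤ.+ + 1) ℤ.+ + k s t) κ ℤ.- + s)) ℚ./ t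

------------------------------------------------------------------------
-- The group G s t and its action on s-cores

record G (s t : ℕ) : Set where
  field
    fun         : ℤ → ℤ
    bijective   : Bijective _≡_ _≡_ fun
    periodic    : ∀ m → fun (m ℤ.+ + s) ≡ fun m ℤ.+ + s
    balanced    : ∑ℤ {s} (λ i → fun (+ toℕ i)) ≡ + (s C 2)
    congruent   : ∀ m → fun m ≡ m [mod t ]
open G public

-- Group elements are equal when they agree as functions.
G-setoid : ℕ → ℕ → Setoid 0ℓ 0ℓ
G-setoid s t = On.setoid (ℤ →-setoid ℤ) (fun {s} {t})

-- μ is the s-core f ν.  As an s-core is determined by its s-set, this pins
-- down μ.
IsImage : ∀ {s t} .{{_ : NonZero s}} → G s t → Partition → Partition → Set
IsImage {s} f ν μ = IsCore s μ ×
  (∀ x → 𝒮 s μ x ⇔ (∃ λ y → 𝒮 s ν y × x ≡ fun f y))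

Stab : (s t : ℕ) .{{_ : NonZero s}} → Partition → Pred (G s t) 0ℓ
Stab s t ν f = IsImage f ν ν

{-# OPTIONS --safe #-}
module Submission where

-- Removing a rim hook of length t replaces one beta-number b by b − t, so ν
-- and its t-core κ have equally many beta-numbers ≥ −n in each class modulo t,
-- for large n.  In the beta-set of κ such a class is a full progression from
-- −n up to a t c κ − t, so these numbers determine a t c κ.  Since B − s ⊆ B
-- for the beta-set B of the s-core ν, and B ∖ (B − s) = 𝒮 s ν − s, comparing
-- the classes c and c + s gives
--   a t c κ − (a t (c + s) κ − s) = t · |(𝒮 s ν − s) ∩ (c + tℤ)|.
--
-- The s-set is a transversal of ℤ modulo s, so an element of the stabiliser is
-- determined by the permutation it induces on the s-set, and every permutation
-- that preserves the classes modulo t extends.  These number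
-- ∏ |𝒮 s ν ∩ (c + tℤ)|!, and j ↦ s j + k permutes the classes modulo t.

open import Defs
import Algebra.Properties.AbelianGroup as AbelianGroup
import Algebra.Properties.CommutativeMonoid.Sum as Sum
open import Data.Bool.Base using (if_then_else_)
open import Data.Fin.Base using (Fin; zero; suc; toℕ; fromℕ; fromℕ<; inject₁; punchIn; punchOut; combine; remQuot)
open import Data.Fin.Permutation using (Permutation′; permutation; _⟨$⟩ʳ_; _⟨$⟩ˡ_; inverseˡ; inverseʳ; insert; remove; insert-punchIn; insert-remove) renaming (id to idₚ)
open import Data.Fin.Properties using (_≟_; any?; toℕ<n; toℕ-fromℕ; toℕ-fromℕ<; toℕ-inject₁; toℕ-injective; punchInᵢ≢i; punchIn-injective; punchOut-injective; injective⇒≤; remQuot-combine; combine-remQuot)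
open import Data.Integer.Base as ℤ using (ℤ; +_; -[1+_]; _+_; _-_; _*_; -_; ∣_∣)
open import Data.Integer.DivMod using (_%ℕ_; _/ℕ_; n%ℕd<d; a≡a%ℕn+[a/ℕn]*n)
open import Data.Integer.Divisibility.Signed using (_∣_; _∣?_; divides; ∣m∣n⇒∣m+n; ∣m⇒∣-m; ∣⇒∣ᵤ; ∣ᵤ⇒∣)
import Data.Integer.Properties as ℤ
open import Data.Integer.Tactic.RingSolver using (solve-∀)
open import Data.List.Base using (List; []; _∷_; _++_; allFin; applyUpTo; filter; length; lookup; tabulate)
open import Data.List.Membership.Propositional using (_∈_)
open import Data.List.Membership.Propositional.Properties using (∈-allFin; ∈-applyUpTo⁺; ∈-applyUpTo⁻; ∈-filter⁺; ∈-filter⁻; ∈-lookup; ∈-tabulate⁺; ∈-tabulate⁻; ∈-++⁺ˡ; ∈-++⁺ʳ; ∈-++⁻)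
open import Data.List.Membership.Propositional.Properties.WithK using (unique∧set⇒bag)
open import Data.List.Properties using (applyUpTo-∷ʳ; filter-++; length-++; length-applyUpTo)
open import Data.List.Relation.Binary.BagAndSetEquality using (∼bag⇒↭)
open import Data.List.Relation.Binary.Permutation.Propositional using (_↭_)
open import Data.List.Relation.Binary.Permutation.Propositional.Properties using (↭-length; filter-↭)
import Data.List.Relation.Unary.All as All
open import Data.List.Relation.Unary.AllPairs using (_∷_)
import Data.List.Relation.Unary.Any as Any
import Data.List.Relation.Unary.Any.Properties as Any
open import Data.List.Relation.Unary.Unique.Propositional using (Unique)
import Data.List.Relation.Unary.Unique.Propositional.Properties as Unique
open import Data.Nat.Base as ℕ using (ℕ; zero; suc; NonZero; z≤n; s≤s; z<s; s<s; s≤s⁻¹; _⊔_; _!)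
open import Data.Nat.Combinatorics using (_C_; nCk+nC[k+1]≡[n+1]C[k+1]; nC1≡n)
open import Data.Nat.Coprimality as Coprimality using (Coprime; coprime-divisor)
import Data.Nat.Divisibility as ℕ
import Data.Nat.Properties as ℕ
open import Data.Product.Base using (∃; _×_; _,_; proj₁; proj₂)
open import Data.Rational.Base using (mkℚ; _/_)
import Data.Rational.Properties as ℚ
open import Data.Rational.Unnormalised.Base using (mkℚᵘ; *≡*)
open import Data.Sum.Base using (inj₁; inj₂)
open import Function.Base using (_∘_; id)
open import Function.Bundles using (Bijection; Equivalence; _⇔_; mk⇔)
open import Level using (0ℓ)
open import Relation.Binary.Bundles using (Setoid)
import Relation.Binary.Construct.On as On
open import Relation.Binary.Construct.Closure.ReflexiveTransitive using (Star; ε; _◅_)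
open import Relation.Binary.Definitions using (tri<; tri≈; tri>)
open import Relation.Binary.PropositionalEquality using (_≡_; _≢_; refl; sym; trans; cong; cong₂; subst; subst₂; setoid; _→-setoid_; module ≡-Reasoning)
open import Relation.Nullary using (¬_; Dec; yes; no; does; contradiction)
open import Relation.Nullary.Decidable using (map′)
open import Relation.Unary using (Pred; Decidable)

open AbelianGroup ℤ.+-0-abelianGroup using () renaming (∙-cancelʳ to +-cancelʳ)
open Equivalence using (to; from)
module ∑ = Sum ℕ.+-0-commutativeMonoid
module ∏ = Sum ℕ.*-1-commutativeMonoid
module ∑ᶻ = Sum ℤ.+-0-commutativeMonoid

-- Congruences and integer inequalities

-- Unlike _≡_[mod_], whose two sides are hidden in a stuck difference, this
-- wrapper lets Agda infer them.
infix 4 _≋_[_]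
record _≋_[_] (x y : ℤ) (n : ℕ) : Set where
  constructor ⟪_⟫
  field unwrap : x ≡ y [mod n ]
open _≋_[_] public

mod-refl : ∀ {n x} → x ≋ x [ n ]
mod-refl {x = x} = ⟪ divides (+ 0) (ℤ.+-inverseʳ x) ⟫

mod-sym : ∀ {n x y} → x ≋ y [ n ] → y ≋ x [ n ]
mod-sym {n} {x} {y} ⟪ p ⟫ = ⟪ subst (+ n ∣_) (identity x y) (∣m⇒∣-m p) ⟫
  where
  identity : ∀ x y → - (x - y) ≡ y - x
  identity = solve-∀

mod-trans : ∀ {n x y z} → x ≋ y [ n ] → y ≋ z [ n ] → x ≋ z [ n ]
mod-trans {n} {x} {y} {z} ⟪ p ⟫ ⟪ q ⟫ = ⟪ subst (+ n ∣_) (identity x y z) (∣m∣n⇒∣m+n p q) ⟫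
  where
  identity : ∀ x y z → (x - y) + (y - z) ≡ x - z
  identity = solve-∀

mod-+ : ∀ {n x y u v} → x ≋ y [ n ] → u ≋ v [ n ] → x + u ≋ y + v [ n ]
mod-+ {n} {x} {y} {u} {v} ⟪ p ⟫ ⟪ q ⟫ = ⟪ subst (+ n ∣_) (identity x y u v) (∣m∣n⇒∣m+n p q) ⟫
  where
  identity : ∀ x y u v → (x - y) + (u - v) ≡ (x + u) - (y + v)
  identity = solve-∀

mod-neg : ∀ {n x y} → x ≋ y [ n ] → - x ≋ - y [ n ]
mod-neg {n} {x} {y} ⟪ p ⟫ = ⟪ subst (+ n ∣_) (identity x y) (∣m⇒∣-m p) ⟫
  where
  identity : ∀ x y → - (x - y) ≡ - x - - y
  identity = solve-∀

mod-multiple : ∀ {n} x q → x + q * + n ≋ x [ n ]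
mod-multiple {n} x q = ⟪ divides q (identity x q (+ n)) ⟫
  where
  identity : ∀ x q n → x + q * n - x ≡ q * n
  identity = solve-∀

mod-shift : ∀ {n} x → x + + n ≋ x [ n ]
mod-shift {n} x = ⟪ divides (+ 1) (identity x (+ n)) ⟫
  where
  identity : ∀ x n → x + n - x ≡ + 1 * n
  identity = solve-∀

mod-unshift : ∀ {n} x → x - + n ≋ x [ n ]
mod-unshift {n} x = ⟪ divides (- + 1) (identity x (+ n)) ⟫
  where
  identity : ∀ x n → x - n - x ≡ - + 1 * n
  identity = solve-∀

_≋?_[_] : ∀ x y n → Dec (x ≋ y [ n ])
x ≋? y [ n ] = map′ ⟪_⟫ unwrap (+ n ∣? (x - y))

-- Two numbers below `n` are less than `n` apart, and the only multiple of `n` that small is 0.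
mod-toℕ-injective : ∀ {n} {i j : Fin n} → + toℕ i ≋ + toℕ j [ n ] → i ≡ j
mod-toℕ-injective {n} {i} {j} ⟪ p ⟫ = toℕ-injective (ℤ.+-injective (ℤ.i-j≡0⇒i≡j _ _ (ℤ.∣i∣≡0⇒i≡0
  (multiple<⇒≡0 (∣⇒∣ᵤ p) (distance< (toℕ<n i) (toℕ<n j))))))
  where
  distance< : ∀ {a b} → a ℕ.< n → b ℕ.< n → ∣ + a - + b ∣ ℕ.< n
  distance< {a} {b} a<n b<n with ℕ.≤-total b a
  ... | inj₁ b≤a rewrite ℤ.m-n≡m⊖n a b | ℤ.⊖-≥ b≤a = ℕ.≤-<-trans (ℕ.m∸n≤m a b) a<n
  ... | inj₂ a≤b rewrite ℤ.m-n≡m⊖n a b | ℤ.∣⊖∣-≤ a≤b = ℕ.≤-<-trans (ℕ.m∸n≤m b a) b<n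

  multiple<⇒≡0 : ∀ {d m} → d ℕ.∣ m → m ℕ.< d → m ≡ 0
  multiple<⇒≡0 {m = zero}  _   _   = refl
  multiple<⇒≡0 {m = suc _} d∣m m<d = contradiction (ℕ.∣⇒≤ d∣m) (ℕ.<⇒≱ m<d)

abstract
  residue : ∀ n .{{_ : NonZero n}} → ℤ → Fin n
  residue n x = fromℕ< (n%ℕd<d x n)

  ≋-residue : ∀ n .{{_ : NonZero n}} x → x ≋ + toℕ (residue n x) [ n ]
  ≋-residue n x = ⟪ divides (x /ℕ n) (trans (cong₂ _-_ (a≡a%ℕn+[a/ℕn]*n x n) (cong +_ (toℕ-fromℕ< (n%ℕd<d x n))))
    (identity (+ (x %ℕ n)) (x /ℕ n * + n))) ⟫
    where
    identity : ∀ r m → (r + m) - r ≡ m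
    identity = solve-∀

residue-unique : ∀ {n} .{{_ : NonZero n}} {x} {i : Fin n} → x ≋ + toℕ i [ n ] → residue n x ≡ i
residue-unique {n} {x} p = mod-toℕ-injective (mod-trans (mod-sym (≋-residue n x)) p)

residue-cong : ∀ {n} .{{_ : NonZero n}} {x y} → x ≋ y [ n ] → residue n x ≡ residue n y
residue-cong {n} {y = y} p = residue-unique (mod-trans p (≋-residue n y))

residue-reflects : ∀ {n} .{{_ : NonZero n}} {x y} → residue n x ≡ residue n y → x ≋ y [ n ]
residue-reflects {n} {x} {y} p =
  mod-trans (≋-residue n x) (subst (λ i → + toℕ i ≋ y [ n ]) (sym p) (mod-sym (≋-residue n y)))

x-y+y≡x : ∀ x y → x - y + y ≡ x
x-y+y≡x = solve-∀

x+y-y≡x : ∀ x y → x + y - y ≡ x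
x+y-y≡x = solve-∀

mod-cancel : ∀ {n x y} u → x - u ≋ y - u [ n ] → x ≋ y [ n ]
mod-cancel {n} {x} {y} u p = subst₂ (_≋_[ n ]) (x-y+y≡x x u) (x-y+y≡x y u) (mod-+ p (mod-refl {x = u}))

-- Transfers an inequality along an equality of differences, which the ring solver can supply.
≤-by : ∀ {a b x y} → a ℤ.≤ b → b - a ≡ y - x → x ℤ.≤ y
≤-by a≤b eq = ℤ.0≤i-j⇒j≤i (subst (+ 0 ℤ.≤_) eq (ℤ.i≤j⇒0≤j-i a≤b))

<-by : ∀ {a b x y} → a ℤ.< b → b - a ≡ y - x → x ℤ.< y
<-by {a} {b} {x} {y} a<b eq = ℤ.suc[i]≤j⇒i<j (≤-by (ℤ.i<j⇒suc[i]≤j a<b) (identity a b x y eq))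
  where
  move : ∀ i j → j - (+ 1 + i) ≡ (j - i) - + 1
  move = solve-∀
  identity : ∀ a b x y → b - a ≡ y - x → b - (+ 1 + a) ≡ y - (+ 1 + x)
  identity a b x y eq = trans (move a b) (trans (cong (_- + 1) eq) (sym (move x y)))

≤⇒+ : ∀ {x y} → x ℤ.≤ y → ∃ λ n → y ≡ x + + n
≤⇒+ {x} {y} x≤y = ∣ y - x ∣ ,
  trans (identity x y) (cong (λ d → x + d) (sym (ℤ.0≤i⇒+∣i∣≡i (ℤ.i≤j⇒0≤j-i x≤y))))
  where
  identity : ∀ x y → y ≡ x + (y - x)
  identity = solve-∀

≤≋⇒multiple : ∀ {n} .{{_ : NonZero n}} {x y} → x ℤ.≤ y → x ≋ y [ n ] → ∃ λ q → y ≡ x + + q * + n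
≤≋⇒multiple {suc n} {x} {y} x≤y x≋y with unwrap (mod-sym x≋y) | ℤ.i≤j⇒0≤j-i x≤y
... | divides (+ q) eq      | _   = q , trans (identity x y) (cong (λ d → x + d) eq)
  where
  identity : ∀ x y → y ≡ x + (y - x)
  identity = solve-∀
... | divides -[1+ q ] eq | 0≤ with () ← subst (+ 0 ℤ.≤_) eq 0≤

-- Counting in lists

-- Lists are compared through this: without repetitions, mutual inclusion already makes their
-- lengths and counts agree.
unique∧set⇒↭ : ∀ {A : Set} {xs ys : List A} → Unique xs → Unique ys →
               (∀ x → x ∈ xs → x ∈ ys) → (∀ x → x ∈ ys → x ∈ xs) → xs ↭ ys
unique∧set⇒↭ xs! ys! ⊆ ⊇ = ∼bag⇒↭ (unique∧set⇒bag xs! ys! (λ {x} → mk⇔ (⊆ x) (⊇ x)))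

count : ∀ {A : Set} {P : Pred A 0ℓ} → Decidable P → List A → ℕ
count P? xs = length (filter P? xs)

count-applyUpTo-cong : ∀ {A B : Set} {P : Pred A 0ℓ} {Q : Pred B 0ℓ} (P? : Decidable P) (Q? : Decidable Q) f g →
                       (∀ i → P (f i) → Q (g i)) → (∀ i → Q (g i) → P (f i)) →
                       ∀ n → count P? (applyUpTo f n) ≡ count Q? (applyUpTo g n)
count-applyUpTo-cong P? Q? f g P⇒Q Q⇒P zero    = refl
count-applyUpTo-cong P? Q? f g P⇒Q Q⇒P (suc n)
  with P? (f 0) | Q? (g 0) | count-applyUpTo-cong P? Q? (f ∘ suc) (g ∘ suc) (P⇒Q ∘ suc) (Q⇒P ∘ suc) n
... | yes _ | yes _ | eq = cong suc eq
... | no  _ | no  _ | eq = eq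
... | yes p | no ¬q | _  = contradiction (P⇒Q 0 p) ¬q
... | no ¬p | yes q | _  = contradiction (Q⇒P 0 q) ¬p

-- Conjugate partitions

module _ {P : Pred ℕ 0ℓ} (P? : Decidable P) where

  -- By `down`, the indices where `P` holds form an initial segment, and the count is the length of
  -- its part below `n`.
  <-count⁺ : ∀ f → (∀ i → P (f (suc i)) → P (f i)) →
             ∀ {n i} → i ℕ.< n → P (f i) → i ℕ.< count P? (applyUpTo f n)
  <-count⁺ f down {suc n} {i} i<n p with P? (f 0)
  <-count⁺ f down {suc n} {zero}  _         p | yes _  = z<s
  <-count⁺ f down {suc n} {suc i} (s<s i<n) p | yes _  = s<s (<-count⁺ (f ∘ suc) (down ∘ suc) i<n p)
  <-count⁺ f down {suc n} {i}     _         p | no ¬p₀ = contradiction (descend i p) ¬p₀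
    where
    descend : ∀ i → P (f i) → P (f 0)
    descend zero    = id
    descend (suc i) = descend i ∘ down i

  <-count⁻ : ∀ f → (∀ i → P (f (suc i)) → P (f i)) →
             ∀ {n i} → i ℕ.< count P? (applyUpTo f n) → P (f i)
  <-count⁻ f down {suc n} {i}     i<c with P? (f 0)
  <-count⁻ f down {suc n} {zero}  _         | yes p  = p
  <-count⁻ f down {suc n} {suc i} (s<s i<c) | yes _  = <-count⁻ (f ∘ suc) (down ∘ suc) {n} i<c
  <-count⁻ f down {suc n} {i}     i<c       | no ¬p₀ =
    down i (<-count⁻ (f ∘ suc) (down ∘ suc) {n} i<c)

-- The cells of column `c` fill an initial segment of rows. Row `r` is among those counted because
-- rows from `bound ν` on are empty.
<part⇒<conjugate : ∀ ν {r c} → c ℕ.< part ν r → r ℕ.< conjugate ν c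
<part⇒<conjugate ν {r} {c} c<p = <-count⁺ (λ r → c ℕ.<? part ν r) id
  (λ i c<p → ℕ.<-≤-trans c<p (decreasing ν i)) (ℕ.≰⇒> beyond) c<p
  where
  beyond : ¬ bound ν ℕ.≤ r
  beyond b≤r = ℕ.n≮0 (subst (c ℕ.<_) (part≡0 ν b≤r) c<p)

<conjugate⇒<part : ∀ ν {r c} → r ℕ.< conjugate ν c → c ℕ.< part ν r
<conjugate⇒<part ν {r} {c} = <-count⁻ (λ r → c ℕ.<? part ν r) id
  (λ i c<p → ℕ.<-≤-trans c<p (decreasing ν i)) {bound ν}

-- Beta-sets

beta-strict : ∀ ν {i j} → i ℕ.< j → beta ν j ℤ.< beta ν i
beta-strict ν i<j = ℤ.+-mono-≤-< (ℤ.+≤+ (part-mono ν (ℕ.<⇒≤ i<j))) (ℤ.neg-mono-< (ℤ.+<+ (s<s i<j)))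

beta-injective : ∀ ν {i j} → beta ν i ≡ beta ν j → i ≡ j
beta-injective ν {i} {j} eq with ℕ.<-cmp i j
... | tri< i<j _ _ = contradiction (sym eq) (ℤ.<⇒≢ (beta-strict ν i<j))
... | tri≈ _ i≡j _ = i≡j
... | tri> _ _ j<i = contradiction eq (ℤ.<⇒≢ (beta-strict ν j<i))

beta-beyond : ∀ ν {i} → bound ν ℕ.≤ i → beta ν i ≡ - + suc i
beta-beyond ν {i} b≤i = trans (cong (λ p → + p - + suc i) (part≡0 ν b≤i)) (ℤ.+-identityˡ _)

-n≤beta : ∀ ν {n i} → i ℕ.< n → - + n ℤ.≤ beta ν i
-n≤beta ν {n} {i} i<n = ℤ.≤-trans (ℤ.neg-mono-≤ (ℤ.+≤+ i<n)) (ℤ.i≤j+i (- + suc i) (+ part ν i))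

-- Row `i ≥ bound ν` has beta-number -(i + 1). So for `n ≥ bound ν` the first `n` beta-numbers are
-- exactly those that are at least -n, and prefixes can be treated as half-lines.
-n≤beta⇒<n : ∀ ν {n i} → bound ν ℕ.≤ n → - + n ℤ.≤ beta ν i → i ℕ.< n
-n≤beta⇒<n ν {n} {i} b≤n le = ℕ.≰⇒> λ n≤i →
  ℤ.<⇒≱ (ℤ.neg-mono-< (ℤ.+<+ (s≤s n≤i))) (subst (- + n ℤ.≤_) (beta-beyond ν (ℕ.≤-trans b≤n n≤i)) le)

<-bound⇒∈ : ∀ ν {y} → y ℤ.< - + bound ν → BetaSet ν y
<-bound⇒∈ ν {+ n}      y<b = contradiction y<b (ℤ.≤⇒≯ (ℤ.≤-trans (ℤ.neg-≤-pos {bound ν} {0}) (ℤ.+≤+ z≤n)))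
<-bound⇒∈ ν { -[1+ i ]} y<b = i , sym (beta-beyond ν (s≤s⁻¹ (ℤ.drop‿+<+ (ℤ.neg-cancel-< y<b))))

-- Here `h` is the number of beta-numbers above `x`. The search descends from a row so far down that
-- its beta-number is at most -|x|.
position : ∀ ν x → ∃ λ h → beta ν h ℤ.≤ x × (∀ i → i ℕ.< h → x ℤ.< beta ν i)
position ν x = go (bound ν ℕ.+ ∣ x ∣) far
  where
  far : beta ν (bound ν ℕ.+ ∣ x ∣) ℤ.≤ x
  far = subst (ℤ._≤ x) (sym (beta-beyond ν (ℕ.m≤m+n (bound ν) ∣ x ∣)))
    (ℤ.≤-trans (ℤ.neg-mono-≤ (ℤ.+≤+ (ℕ.m≤n⇒m≤1+n (ℕ.m≤n+m ∣ x ∣ (bound ν))))) (-∣i∣≤i x))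
    where
    -∣i∣≤i : ∀ i → - + ∣ i ∣ ℤ.≤ i
    -∣i∣≤i (+ n)    = ℤ.neg-≤-pos {n} {n}
    -∣i∣≤i -[1+ n ] = ℤ.≤-refl

  go : ∀ N → beta ν N ℤ.≤ x → ∃ λ h → beta ν h ℤ.≤ x × (∀ i → i ℕ.< h → x ℤ.< beta ν i)
  go zero    le = 0 , le , λ _ ()
  go (suc N) le with beta ν N ℤ.≤? x
  ... | yes le′ = go N le′
  ... | no  ≰x  = suc N , le , λ i i<1+N → ℤ.<-≤-trans (ℤ.≰⇒> ≰x) (beta-mono ν (s≤s⁻¹ i<1+N))

_∈β?_ : ∀ x ν → Dec (BetaSet ν x)
x ∈β? ν with position ν x
... | h , βh≤x , x<β with beta ν h ℤ.≟ x
...   | yes βh≡x = yes (h , sym βh≡x)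
...   | no  βh≢x = no λ (i , x≡) → elsewhere i x≡
  where
  elsewhere : ∀ i → x ≢ beta ν i
  elsewhere i refl with ℕ.<-≤-connex i h
  ... | inj₁ i<h = ℤ.<-irrefl refl (x<β i i<h)
  ... | inj₂ h≤i = βh≢x (ℤ.≤-antisym βh≤x (beta-mono ν h≤i))

-- In abacus terms: on each of the `s` runners the beads leave no gap.
Flush : ℕ → Partition → Set
Flush s ν = ∀ {b} → BetaSet ν b → BetaSet ν (b - + s)

-- Suppose x = `beta ν r` - s is not a beta-number and `suc h` beta-numbers exceed it. Then c = x +
-- `suc h` satisfies `part ν (suc h)` ≤ c < `part ν h`, so column c has exactly `suc h` cells, and
-- the hook of (r , c) has length `beta ν r` - x = s.
core⇒flush : ∀ s .{{_ : NonZero s}} ν → IsCore s ν → Flush s ν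
core⇒flush s ν core (r , refl) with position ν (beta ν r - + s)
... | h , βh≤x , x<β with beta ν h ℤ.≟ beta ν r - + s
...   | yes βh≡x = h , sym βh≡x
...   | no  βh≢x with ℕ.<-≤-connex r h
...     | inj₂ h≤r = contradiction (ℤ.≤-trans (beta-mono ν h≤r) βh≤x)
            (ℤ.<⇒≱ (i-s<i (beta ν r)))
          where
          i-s<i : ∀ i → i - + s ℤ.< i
          i-s<i i = <-by {+ 0} {+ s} (ℤ.+<+ (ℕ.>-nonZero⁻¹ s)) (identity i (+ s))
            where
            identity : ∀ i s → s - + 0 ≡ i - (i - s)
            identity = solve-∀
core⇒flush s ν core (r , refl) | suc h , βh≤x , x<β | no βh≢x | inj₁ r<h =
  contradiction hook≡s (core (r , c) c<part-r)
  where
  x = beta ν r - + s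
  -- The inequality between `beta ν (suc h)` and `x` is strict; this absorbs the difference between
  -- `suc h` and `suc (suc h)`.
  part≤ : + part ν (suc h) ℤ.≤ x + + suc h
  part≤ = ≤-by (ℤ.i<j⇒suc[i]≤j (ℤ.≤∧≢⇒< βh≤x βh≢x)) (identity x (+ part ν (suc h)) (+ h))
    where
    identity : ∀ x p h → x - (+ 1 + (p - (+ 1 + (+ 1 + h)))) ≡ x + (+ 1 + h) - p
    identity = solve-∀
  -- Obtained as `part ν (suc h)` plus a natural number, so that the integer x + `suc h` becomes a
  -- column index.
  c : ℕ
  c = part ν (suc h) ℕ.+ proj₁ (≤⇒+ part≤)
  c≡ : + c ≡ x + + suc h
  c≡ = sym (proj₂ (≤⇒+ part≤))
  c<part-h : c ℕ.< part ν h
  c<part-h = ℤ.drop‿+<+ (<-by (x<β h ℕ.≤-refl)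
    (trans (identity x (+ part ν h) (+ suc h)) (cong (λ c → + part ν h - c) (sym c≡))))
    where
    identity : ∀ x p h → p - h - x ≡ p - (x + h)
    identity = solve-∀
  c<part-r : c ℕ.< part ν r
  c<part-r = ℕ.<-≤-trans c<part-h (part-mono ν (s≤s⁻¹ r<h))
  conj≡ : conjugate ν c ≡ suc h
  conj≡ = ℕ.≤-antisym
    (ℕ.≮⇒≥ λ lt → ℕ.<⇒≱ (<conjugate⇒<part ν lt) (ℕ.m≤m+n (part ν (suc h)) _))
    (<part⇒<conjugate ν c<part-h)
  hook≡s : hookLength ν (r , c) ≡ + s
  hook≡s = begin
    + 1 + beta ν r + (+ conjugate ν c - (+ 1 + + c)) ≡⟨ cong₂ (λ k c → + 1 + beta ν r + (+ k - (+ 1 + c))) conj≡ c≡ ⟩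
    + 1 + beta ν r + (+ suc h - (+ 1 + (beta ν r - + s + + suc h))) ≡⟨ identity (beta ν r) (+ suc h) (+ s) ⟩
    + s ∎
    where
    open ≡-Reasoning
    identity : ∀ b h s → + 1 + b + (h - (+ 1 + (b - s + h))) ≡ s
    identity = solve-∀

-- Rim hook removal

module _ {P : Pred ℤ 0ℓ} (P? : Decidable P) where

  count-applyUpTo-suc : ∀ f n → count P? (applyUpTo f (suc n)) ≡ count P? (applyUpTo f n) ℕ.+ count P? (f n ∷ [])
  count-applyUpTo-suc f n = begin
    count P? (applyUpTo f (suc n))                              ≡⟨ cong (count P?) (applyUpTo-∷ʳ f n) ⟨
    count P? (applyUpTo f n ++ f n ∷ [])                        ≡⟨ cong length (filter-++ P? (applyUpTo f n) (f n ∷ [])) ⟩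
    length (filter P? (applyUpTo f n) ++ filter P? (f n ∷ []))  ≡⟨ length-++ (filter P? (applyUpTo f n)) ⟩
    count P? (applyUpTo f n) ℕ.+ count P? (f n ∷ [])            ∎
    where open ≡-Reasoning

  -- On the indices r, ..., h the sequence `g` is `f` rotated by one place, with `f r` replaced by a
  -- value that counts the same. Prefixes reaching past `h` therefore have equal counts.
  count-rotate : ∀ f g r h → r ℕ.≤ h →
                 (∀ i → i ℕ.< r → g i ≡ f i) →
                 (∀ i → r ℕ.≤ i → i ℕ.< h → g i ≡ f (suc i)) →
                 (∀ i → h ℕ.< i → g i ≡ f i) →
                 count P? (g h ∷ []) ≡ count P? (f r ∷ []) →
                 ∀ n → h ℕ.< n → count P? (applyUpTo g n) ≡ count P? (applyUpTo f n)
  count-rotate f g r h r≤h g≡f g≡f∘suc g≡f′ [gh]≡[fr] = after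
    where
    open ≡-Reasoning
    # : (ℕ → ℤ) → ℕ → ℕ
    # f n = count P? (applyUpTo f n)
    [_] : ℤ → ℕ
    [ x ] = count P? (x ∷ [])

    snoc-cong : ∀ {m n} → # g m ≡ # f n → g m ≡ f n → # g (suc m) ≡ # f (suc n)
    snoc-cong {m} {n} p q = trans (count-applyUpTo-suc g m)
      (trans (cong₂ (λ a x → a ℕ.+ [ x ]) p q) (sym (count-applyUpTo-suc f n)))

    before : ∀ n → n ℕ.≤ r → # g n ≡ # f n
    before zero    _   = refl
    before (suc n) n<r = snoc-cong (before n (ℕ.<⇒≤ n<r)) (g≡f n n<r)

    -- Inside the rotated block, a prefix of `g` lacks only the contribution of `f r` to the next
    -- longer prefix of `f`.
    during : ∀ n → r ℕ.≤ n → n ℕ.≤ h → # g n ℕ.+ [ f r ] ≡ # f (suc n)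
    during n r≤n n≤h with ℕ.m≤n⇒m<n∨m≡n r≤n
    ... | inj₂ refl = trans (cong (ℕ._+ [ f r ]) (before r ℕ.≤-refl)) (sym (count-applyUpTo-suc f r))
    during (suc n) r≤n n<h | inj₁ (s≤s r≤n′) = begin
      # g (suc n) ℕ.+ [ f r ]            ≡⟨ cong (ℕ._+ [ f r ]) (count-applyUpTo-suc g n) ⟩
      # g n ℕ.+ [ g n ] ℕ.+ [ f r ]      ≡⟨ ℕ.+-assoc (# g n) _ _ ⟩
      # g n ℕ.+ ([ g n ] ℕ.+ [ f r ])    ≡⟨ cong (# g n ℕ.+_) (ℕ.+-comm [ g n ] _) ⟩
      # g n ℕ.+ ([ f r ] ℕ.+ [ g n ])    ≡⟨ ℕ.+-assoc (# g n) _ _ ⟨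
      # g n ℕ.+ [ f r ] ℕ.+ [ g n ]      ≡⟨ cong₂ (λ a x → a ℕ.+ [ x ]) (during n r≤n′ (ℕ.<⇒≤ n<h)) (g≡f∘suc n r≤n′ n<h) ⟩
      # f (suc n) ℕ.+ [ f (suc n) ]      ≡⟨ count-applyUpTo-suc f (suc n) ⟨
      # f (suc (suc n))                  ∎

    after : ∀ n → h ℕ.< n → # g n ≡ # f n
    after (suc n) (s≤s h≤n) with ℕ.m≤n⇒m<n∨m≡n h≤n
    ... | inj₁ h<n  = snoc-cong (after n h<n) (g≡f′ n h<n)
    ... | inj₂ refl = begin
      # g (suc h)              ≡⟨ count-applyUpTo-suc g h ⟩
      # g h ℕ.+ [ g h ]        ≡⟨ cong (# g h ℕ.+_) [gh]≡[fr] ⟩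
      # g h ℕ.+ [ f r ]        ≡⟨ during h r≤h ℕ.≤-refl ⟩
      # f (suc h)              ∎

-- For `n ≥ bound ν` this counts the beta-numbers in the class of `c` modulo `t` that are at least
-- -n.
#β : ℕ → ℤ → Partition → ℕ → ℕ
#β t c ν n = count (_≋? c [ t ]) (applyUpTo (beta ν) n)

count-≋-singleton : ∀ {t c x y} → x ≋ y [ t ] → count (_≋? c [ t ]) (x ∷ []) ≡ count (_≋? c [ t ]) (y ∷ [])
count-≋-singleton {t} {c} {x} {y} x≋y = count-applyUpTo-cong (_≋? c [ t ]) (_≋? c [ t ]) (λ _ → x) (λ _ → y)
  (λ _ → mod-trans (mod-sym x≋y)) (λ _ → mod-trans x≋y) 1

-- Row lengths are compared through the cells of the rows, as `RemoveHook` describes the smaller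
-- partition by its cells only.
<-ext⇒≤ : ∀ {m n} → (∀ j → j ℕ.< m → j ℕ.< n) → m ℕ.≤ n
<-ext⇒≤ {zero}  _ = z≤n
<-ext⇒≤ {suc m} f = f m ℕ.≤-refl

<⇒≡suc : ∀ {m n} → m ℕ.< n → ∃ λ k → n ≡ suc k × m ℕ.≤ k
<⇒≡suc (s≤s m≤k) = _ , refl , m≤k

-- The threshold is there because a removal rearranges the residues of the rows from the head to the
-- foot of the hook; a prefix ending between them may have different counts.
SameResidueCounts : ℕ → Partition → Partition → Set
SameResidueCounts t μ ν = ∃ λ n₀ → ∀ n → n₀ ℕ.≤ n → ∀ c → #β t c μ n ≡ #β t c ν n

-- Removing the rim hook of the cell (r , c) with foot in row h moves the
-- beta-numbers of the rows r + 1, …, h up by one row, and row h gets the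
-- beta-number of row r, lowered by t.
removeHook-#β : ∀ {t ν μ} → RemoveHook t ν μ → SameResidueCounts t μ ν
removeHook-#β {t} {ν} {μ} ((r , c) , c<part , hook≡t , μ⇔) with <⇒≡suc (<part⇒<conjugate ν c<part)
... | h , conj≡ , r≤h = suc h , λ n h<n d → count-rotate (_≋? d [ t ]) (beta ν) (beta μ) r h r≤h
    (λ i i<r → cong (λ p → + p - + suc i) (unchanged i λ j (_ , r≤i , _) → ℕ.<⇒≱ i<r r≤i))
    shifted
    (λ i h<i → cong (λ p → + p - + suc i) (unchanged i λ j (j<p , _ , c≤j , _) → ℕ.<⇒≱ j<p (ℕ.≤-trans (part≤c h<i) c≤j)))
    (count-≋-singleton (subst (_≋ beta ν r [ t ]) (sym last) (mod-unshift (beta ν r))))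
    n h<n
  where
  part≤c : ∀ {i} → h ℕ.< i → part ν i ℕ.≤ c
  part≤c {i} h<i = ℕ.≮⇒≥ λ c<p → ℕ.<⇒≱ (subst (i ℕ.<_) conj≡ (<part⇒<conjugate ν c<p)) h<i

  c<part′ : ∀ {i} → i ℕ.≤ h → c ℕ.< part ν i
  c<part′ {i} i≤h = <conjugate⇒<part ν (subst (i ℕ.<_) (sym conj≡) (s≤s i≤h))

  unchanged : ∀ i → (∀ j → ¬ RimHook ν (r , c) (i , j)) → part μ i ≡ part ν i
  unchanged i ¬rim = ℕ.≤-antisym (<-ext⇒≤ λ j → proj₁ ∘ to (μ⇔ (i , j)))
    (<-ext⇒≤ λ j j<p → from (μ⇔ (i , j)) (j<p , ¬rim j))

  -- Above the foot, the hook occupies row `i` from column `part ν (suc i)` - 1 on, so the row is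
  -- cut to that length.
  shifted : ∀ i → r ℕ.≤ i → i ℕ.< h → beta μ i ≡ beta ν (suc i)
  shifted i r≤i i<h with part ν (suc i) in part≡ | c<part′ i<h
  ... | suc p | s≤s c≤p = trans (cong (λ p → + p - + suc i) part-μ) (identity (+ p) (+ suc i))
    where
    identity : ∀ p i → p - i ≡ (+ 1 + p) - (+ 1 + i)
    identity = solve-∀
    part-μ : part μ i ≡ p
    part-μ = ℕ.≤-antisym
      (<-ext⇒≤ λ j j<μ → ℕ.≰⇒> λ p≤j → proj₂ (to (μ⇔ (i , j)) j<μ)
        (proj₁ (to (μ⇔ (i , j)) j<μ) , r≤i , ℕ.≤-trans c≤p p≤j ,
          λ 1+j<p → ℕ.<⇒≱ 1+j<p (subst (ℕ._≤ suc j) (sym part≡) (s≤s p≤j))))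
      (<-ext⇒≤ λ j j<p → from (μ⇔ (i , j))
        ( ℕ.<-≤-trans (ℕ.m<n⇒m<1+n j<p) (subst (ℕ._≤ part ν i) part≡ (decreasing ν i))
        , λ (_ , _ , _ , ∉ν) → ∉ν (subst (suc j ℕ.<_) (sym part≡) (s≤s j<p))))

  -- Row h + 1 ends at or before column `c`, so in row `h` every cell from column `c` on belongs to
  -- the rim, and the row is cut to length `c`.
  last : beta μ h ≡ beta ν r - + t
  last = begin
    + part μ h - + suc h                               ≡⟨ cong (λ p → + p - + suc h) part-μ ⟩
    + c - + suc h                                      ≡⟨ identity (beta ν r) (+ suc h) (+ c) ⟩
    beta ν r - (+ 1 + beta ν r + (+ suc h - (+ 1 + + c))) ≡⟨ cong (λ k → beta ν r - (+ 1 + beta ν r + (+ k - (+ 1 + + c)))) conj≡ ⟨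
    beta ν r - hookLength ν (r , c)                    ≡⟨ cong (λ l → beta ν r - l) hook≡t ⟩
    beta ν r - + t                                     ∎
    where
    open ≡-Reasoning
    identity : ∀ b h c → c - h ≡ b - (+ 1 + b + (h - (+ 1 + c)))
    identity = solve-∀
    part-μ : part μ h ≡ c
    part-μ = ℕ.≤-antisym
      (<-ext⇒≤ λ j j<μ → ℕ.≰⇒> λ c≤j → proj₂ (to (μ⇔ (h , j)) j<μ)
        (proj₁ (to (μ⇔ (h , j)) j<μ) , r≤h , c≤j ,
          λ 1+j<p → ℕ.<⇒≱ 1+j<p (ℕ.≤-trans (part≤c ℕ.≤-refl) (ℕ.m≤n⇒m≤1+n c≤j))))
      (<-ext⇒≤ λ j j<c → from (μ⇔ (h , j))
        (ℕ.<-trans j<c (c<part′ ℕ.≤-refl) , λ (_ , _ , c≤j , _) → ℕ.<⇒≱ j<c c≤j))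

coreOf-#β : ∀ {t ν κ} → Star (RemoveHook t) ν κ → SameResidueCounts t κ ν
coreOf-#β ε = 0 , λ _ _ _ → refl
coreOf-#β {t} {ν} {κ} (_◅_ {j = μ} step steps) = compose (coreOf-#β steps) (removeHook-#β {t} {ν} {μ} step)
  where
  compose : SameResidueCounts t κ μ → SameResidueCounts t μ ν → SameResidueCounts t κ ν
  compose (n₁ , eq₁) (n₂ , eq₂) = n₁ ⊔ n₂ , λ n le c →
    trans (eq₁ n (ℕ.≤-trans (ℕ.m≤m⊔n n₁ n₂) le) c) (eq₂ n (ℕ.≤-trans (ℕ.m≤n⊔m n₁ n₂) le) c)

-- Maxima of residue classes

top : (s : ℕ) .{{_ : NonZero s}} → Partition → ℤ → ℤ
top s ν i = proj₁ (maxBeta ν s i)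

module _ (s : ℕ) .{{_ : NonZero s}} (ν : Partition) where

  top-∈ : ∀ i → BetaSet ν (top s ν i)
  top-∈ i = proj₁ (proj₁ (proj₂ (maxBeta ν s i)))

  top-≋ : ∀ i → top s ν i ≋ i [ s ]
  top-≋ i = ⟪ proj₂ (proj₁ (proj₂ (maxBeta ν s i))) ⟫

  top-max : ∀ {i b} → BetaSet ν b → b ≋ i [ s ] → b ℤ.≤ top s ν i
  top-max {i} b∈ b≋i = proj₂ (proj₂ (maxBeta ν s i)) _ (b∈ , unwrap b≋i)

  top-cong : ∀ {i j} → i ≋ j [ s ] → top s ν i ≡ top s ν j
  top-cong {i} {j} i≋j = ℤ.≤-antisym
    (top-max (top-∈ i) (mod-trans (top-≋ i) i≋j))
    (top-max (top-∈ j) (mod-trans (top-≋ j) (mod-sym i≋j)))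

  x<x+s : ∀ x → x ℤ.< x + + s
  x<x+s x = <-by {+ 0} {+ s} (ℤ.+<+ (ℕ.>-nonZero⁻¹ s)) (identity x (+ s))
    where
    identity : ∀ x s → s - + 0 ≡ x + s - x
    identity = solve-∀

  top+s∉ : ∀ i → ¬ BetaSet ν (top s ν i + + s)
  top+s∉ i ∈ν = ℤ.<⇒≱ (x<x+s (top s ν i)) (top-max ∈ν (mod-trans (mod-shift _) (top-≋ i)))

  module _ (flush : Flush s ν) where

    flush-* : ∀ q {b} → BetaSet ν b → BetaSet ν (b - + q * + s)
    flush-* zero    {b} b∈ = subst (BetaSet ν) (sym (ℤ.+-identityʳ b)) b∈
    flush-* (suc q) {b} b∈ = subst (BetaSet ν) (identity b (+ q) (+ s)) (flush (flush-* q b∈))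
      where
      identity : ∀ b q s → b - q * s - s ≡ b - (+ 1 + q) * s
      identity = solve-∀

    flush-≤ : ∀ {x b} → BetaSet ν b → x ℤ.≤ b → x ≋ b [ s ] → BetaSet ν x
    flush-≤ {x} b∈ x≤b x≋b with ≤≋⇒multiple x≤b x≋b
    ... | q , refl = subst (BetaSet ν) (x+y-y≡x x (+ q * + s)) (flush-* q b∈)

    -- If the largest element of the class were b + (q + 1)s, flushness would bring it down `q`
    -- steps to b + s.
    end⇒top : ∀ {b} → BetaSet ν b → ¬ BetaSet ν (b + + s) → b ≡ top s ν b
    end⇒top {b} b∈ b+s∉ = only (top-∈ b) (≤≋⇒multiple (top-max b∈ mod-refl) (mod-sym (top-≋ b)))
      where
      only : ∀ {m} → BetaSet ν m → (∃ λ q → m ≡ b + + q * + s) → b ≡ m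
      only _  (zero  , refl) = sym (ℤ.+-identityʳ b)
      only m∈ (suc q , refl) = contradiction (subst (BetaSet ν) (identity b (+ q) (+ s)) (flush-* q m∈)) b+s∉
        where
        identity : ∀ b q s → b + (+ 1 + q) * s - q * s ≡ b + s
        identity = solve-∀

-- The s-set

  -- The s-set indexed by residues: `σ i` is its element congruent to `i`.
  σ : Fin s → ℤ
  σ i = a s (+ toℕ i) ν

  a-≋ : ∀ i → a s i ν ≋ i [ s ]
  a-≋ i = mod-trans (subst (_≋ top s ν i [ s ]) (ℤ.+-comm (top s ν i) (+ s)) (mod-shift (top s ν i))) (top-≋ i)

  σ-injective : ∀ {i j} → σ i ≡ σ j → i ≡ j
  σ-injective {i} {j} eq = mod-toℕ-injective (mod-trans (mod-sym (a-≋ (+ toℕ i))) (subst (_≋ + toℕ j [ s ]) (sym eq) (a-≋ (+ toℕ j))))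

  a-residue : ∀ i → a s i ν ≡ σ (residue s i)
  a-residue i = cong (λ m → + s + m) (top-cong (≋-residue s i))

  𝒮⇒σ : ∀ {x} → 𝒮 s ν x → x ≡ σ (residue s x)
  𝒮⇒σ (i , refl) = trans (a-residue i) (cong σ (residue-cong (mod-sym (a-≋ i))))

  σ-s : ∀ i → σ i - + s ≡ top s ν (+ toℕ i)
  σ-s i = identity (top s ν (+ toℕ i)) (+ s)
    where
    identity : ∀ m s → s + m - s ≡ m
    identity = solve-∀

  -- As m ≥ `bound ν`, the prefixes are the beta-numbers at least -(m + s) and at least -m. A
  -- beta-number b either has b + s in the beta-set too, and then lies in the first list, or is the
  -- largest of its class modulo `s`, and then is an element of the s-set lowered by `s`.
  beta-split : Flush s ν → ∀ {m} → bound ν ℕ.≤ m →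
    applyUpTo (beta ν) (m ℕ.+ s) ↭ applyUpTo (λ i → beta ν i - + s) m ++ tabulate (λ i → σ i - + s)
  beta-split flush {m} b≤m = unique∧set⇒↭
    (Unique.applyUpTo⁺₁ (beta ν) (m ℕ.+ s) λ i<j _ eq → ℕ.<⇒≢ i<j (beta-injective ν eq))
    (Unique.++⁺
      (Unique.applyUpTo⁺₁ _ m λ i<j _ eq → ℕ.<⇒≢ i<j (beta-injective ν (+-cancelʳ (- + s) _ _ eq)))
      (Unique.tabulate⁺ λ eq → σ-injective (+-cancelʳ (- + s) _ _ eq))
      disjoint)
    forward backward
    where
    b≤m+s : bound ν ℕ.≤ m ℕ.+ s
    b≤m+s = ℕ.≤-trans b≤m (ℕ.m≤m+n m s)

    lower : ∀ {x} → - + (m ℕ.+ s) ℤ.≤ x → - + m ℤ.≤ x + + s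
    lower {x} le = ≤-by le (identity x (+ m) (+ s))
      where
      identity : ∀ x m s → x - - (m + s) ≡ x + s - - m
      identity = solve-∀

    raise : ∀ {x} → - + m ℤ.≤ x + + s → - + (m ℕ.+ s) ℤ.≤ x
    raise {x} le = ≤-by le (identity x (+ m) (+ s))
      where
      identity : ∀ x m s → x + s - - m ≡ x - - (m + s)
      identity = solve-∀

    disjoint : ∀ {x} → ¬ (x ∈ applyUpTo (λ i → beta ν i - + s) m × x ∈ tabulate (λ i → σ i - + s))
    disjoint (x∈₁ , x∈₂) with ∈-applyUpTo⁻ _ x∈₁ | ∈-tabulate⁻ x∈₂
    ... | i , _ , refl | j , eq = top+s∉ (+ toℕ j) (i , trans (cong (_+ + s) (sym (trans eq (σ-s j)))) (x-y+y≡x (beta ν i) (+ s)))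

    forward : ∀ x → x ∈ applyUpTo (beta ν) (m ℕ.+ s) → x ∈ applyUpTo (λ i → beta ν i - + s) m ++ tabulate (λ i → σ i - + s)
    forward x x∈ with ∈-applyUpTo⁻ (beta ν) x∈
    ... | i , i<m+s , refl with (beta ν i + + s) ∈β? ν
    ...   | yes (j , eq) = ∈-++⁺ˡ (subst (_∈ applyUpTo _ m) (trans (cong (_- + s) (sym eq)) (x+y-y≡x (beta ν i) (+ s)))
              (∈-applyUpTo⁺ (λ i → beta ν i - + s) (-n≤beta⇒<n ν b≤m
                (subst (- + m ℤ.≤_) eq (lower (-n≤beta ν i<m+s))))))
    ...   | no  ∉ν = ∈-++⁺ʳ _ (subst (_∈ tabulate (λ i → σ i - + s))
              (trans (σ-s (residue s (beta ν i)))
                (trans (top-cong (mod-sym (≋-residue s (beta ν i)))) (sym (end⇒top flush (i , refl) ∉ν))))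
              (∈-tabulate⁺ (residue s (beta ν i))))

    backward : ∀ x → x ∈ applyUpTo (λ i → beta ν i - + s) m ++ tabulate (λ i → σ i - + s) → x ∈ applyUpTo (beta ν) (m ℕ.+ s)
    backward x x∈ with ∈-++⁻ (applyUpTo (λ i → beta ν i - + s) m) x∈
    backward x x∈ | inj₁ x∈₁ with ∈-applyUpTo⁻ _ x∈₁
    ... | i , i<m , refl with flush (i , refl)
    ...   | j , eq = subst (_∈ applyUpTo (beta ν) (m ℕ.+ s)) (sym eq) (∈-applyUpTo⁺ (beta ν)
              (-n≤beta⇒<n ν b≤m+s (subst (- + (m ℕ.+ s) ℤ.≤_) eq
                (raise (subst (- + m ℤ.≤_) (sym (x-y+y≡x (beta ν i) (+ s))) (-n≤beta ν i<m))))))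
    backward x x∈ | inj₂ x∈₂ with ∈-tabulate⁻ x∈₂
    ... | i , refl with top-∈ (+ toℕ i)
    -- The largest element of a class is at least -(m + s): its translate by `s` is not a
    -- beta-number, whereas every integer below -`bound ν` is one.
    ...   | j , eq = subst (_∈ applyUpTo (beta ν) (m ℕ.+ s)) (sym (trans (σ-s i) eq)) (∈-applyUpTo⁺ (beta ν)
              (-n≤beta⇒<n ν b≤m+s (subst (- + (m ℕ.+ s) ℤ.≤_) eq
                (raise (ℤ.≤-trans (ℤ.neg-mono-≤ (ℤ.+≤+ b≤m)) (ℤ.≮⇒≥ (top+s∉ (+ toℕ i) ∘ <-bound⇒∈ ν)))))))

-- Residue counts of a core

-- Without gaps, the beta-numbers of the class from -n on are the progression -n, -n + t, ..., m,
-- which has `q` terms since m + t = -n + qt. It is empty when m = -n - t.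
#β-flush : ∀ t .{{_ : NonZero t}} κ → Flush t κ → ∀ {n c m q} → bound κ ℕ.≤ n → - + n ≋ c [ t ] →
           BetaSet κ m → m ≋ c [ t ] → (∀ {b} → BetaSet κ b → b ≋ c [ t ] → b ℤ.≤ m) →
           m + + t ≡ - + n + + q * + t → q ≡ #β t c κ n
#β-flush t κ flush {n} {c} {m} {q} b≤n -n≋c m∈ m≋c m-max m+t≡ =
  trans (sym (length-applyUpTo progression q)) (sym (↭-length (unique∧set⇒↭
    (Unique.filter⁺ (_≋? c [ t ]) (Unique.applyUpTo⁺₁ (beta κ) n λ i<j _ eq → ℕ.<⇒≢ i<j (beta-injective κ eq)))
    (Unique.applyUpTo⁺₁ progression q λ i<j _ eq → ℤ.<⇒≢ (progression< i<j) eq)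
    forward backward)))
  where
  progression : ℕ → ℤ
  progression j = - + n + + j * + t

  progression-mono : ∀ {i j} → i ℕ.≤ j → progression i ℤ.≤ progression j
  progression-mono i≤j = ℤ.+-monoʳ-≤ (- + n) (ℤ.*-monoʳ-≤-nonNeg (+ t) (ℤ.+≤+ i≤j))

  progression-suc : ∀ j → progression (suc j) ≡ progression j + + t
  progression-suc j = identity (- + n) (+ j) (+ t)
    where
    identity : ∀ n j t → n + (+ 1 + j) * t ≡ n + j * t + t
    identity = solve-∀

  progression< : ∀ {i j} → i ℕ.< j → progression i ℤ.< progression j
  progression< {i} i<j = ℤ.<-≤-trans (subst (progression i ℤ.<_) (sym (progression-suc i)) (x<x+s t κ (progression i)))
    (progression-mono i<j)

  progression-≋ : ∀ j → progression j ≋ c [ t ]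
  progression-≋ j = mod-trans (mod-multiple (- + n) (+ j)) -n≋c

  forward : ∀ x → x ∈ filter (_≋? c [ t ]) (applyUpTo (beta κ) n) → x ∈ applyUpTo progression q
  forward x x∈ with ∈-filter⁻ (_≋? c [ t ]) {xs = applyUpTo (beta κ) n} x∈
  ... | x∈′ , x≋c with ∈-applyUpTo⁻ (beta κ) x∈′
  ...   | i , i<n , refl with ≤≋⇒multiple (-n≤beta κ i<n) (mod-trans -n≋c (mod-sym x≋c))
  ...     | j , eq = subst (_∈ applyUpTo progression q) (sym eq) (∈-applyUpTo⁺ progression (ℕ.≰⇒> q≰j))
    where
    q≰j : ¬ q ℕ.≤ j
    q≰j q≤j = ℤ.<⇒≱ (x<x+s t κ m) (ℤ.≤-trans (ℤ.≤-reflexive m+t≡)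
      (ℤ.≤-trans (progression-mono q≤j) (subst (ℤ._≤ m) eq (m-max (i , refl) x≋c))))

  progression-∈ : ∀ {j} → j ℕ.< q → BetaSet κ (progression j)
  progression-∈ {j} j<q = flush-≤ t κ flush m∈ x≤m (mod-trans (progression-≋ j) (mod-sym m≋c))
    where
    x≤m : progression j ℤ.≤ m
    x≤m = ≤-by (subst₂ ℤ._≤_ (progression-suc j) (sym m+t≡) (progression-mono j<q))
      (identity m (progression j) (+ t))
      where
      identity : ∀ m x t → m + t - (x + t) ≡ m - x
      identity = solve-∀

  backward : ∀ x → x ∈ applyUpTo progression q → x ∈ filter (_≋? c [ t ]) (applyUpTo (beta κ) n)
  backward x x∈ with ∈-applyUpTo⁻ progression x∈
  ... | j , j<q , refl = ∈-filter⁺ (_≋? c [ t ]) (in-range (progression-∈ j<q)) (progression-≋ j)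
    where
    in-range : BetaSet κ (progression j) → progression j ∈ applyUpTo (beta κ) n
    in-range (i , eq) = subst (_∈ applyUpTo (beta κ) n) (sym eq) (∈-applyUpTo⁺ (beta κ) (-n≤beta⇒<n κ b≤n
      (subst (- + n ℤ.≤_) eq (subst (ℤ._≤ progression j) (ℤ.+-identityʳ (- + n)) (progression-mono {0} {j} z≤n)))))

core-a : ∀ t .{{_ : NonZero t}} κ → Flush t κ → ∀ {n c} → bound κ ℕ.≤ n → - + n ≋ c [ t ] →
         a t c κ ≡ - + n + + #β t c κ n * + t
core-a t κ flush {n} {c} b≤n -n≋c = conclude (≤≋⇒multiple -n≤a (mod-trans -n≋c (mod-sym (a-≋ t κ c))))
  where
  m = top t κ c

  a≡m+t : a t c κ ≡ m + + t
  a≡m+t = ℤ.+-comm (+ t) m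

  -n-t<-bound : - + n - + t ℤ.< - + bound κ
  -n-t<-bound = ℤ.<-≤-trans (<-by (x<x+s t κ (- + n)) (identity (- + n) (+ t))) (ℤ.neg-mono-≤ (ℤ.+≤+ b≤n))
    where
    identity : ∀ n t → n + t - n ≡ n - (n - t)
    identity = solve-∀

  -- The class may have no beta-number from -n on, but -n - t always is one; so `a` is at least -n,
  -- with equality when the count is 0.
  -n≤a : - + n ℤ.≤ a t c κ
  -n≤a = ≤-by (top-max t κ (<-bound⇒∈ κ -n-t<-bound) (mod-trans (mod-unshift (- + n)) -n≋c)) (identity (+ n) (+ t) m)
    where
    identity : ∀ n t m → m - (- n - t) ≡ t + m - - n
    identity = solve-∀

  conclude : (∃ λ q → a t c κ ≡ - + n + + q * + t) → a t c κ ≡ - + n + + #β t c κ n * + t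
  conclude (q , a≡) = trans a≡ (cong (λ q → - + n + + q * + t)
    (#β-flush t κ flush {q = q} b≤n -n≋c (top-∈ t κ c) (top-≋ t κ c) (top-max t κ) (trans (sym a≡m+t) a≡)))

-- Comparing the classes of c and c + s

#𝒮 : ∀ s .{{_ : NonZero s}} → ℕ → Partition → ℤ → ℕ
#𝒮 s t ν c = count (_≋? c [ t ]) (tabulate (λ i → σ s ν i - + s))

module _ (s t : ℕ) .{{_ : NonZero s}} .{{_ : NonZero t}} (ν κ : Partition)
         (ν-core : IsCore s ν) (ν-κ : IsCoreOf t ν κ) where

  -- Each `a` is a count for `κ`: class `c` from -(m + s) on, class c + s from -m on. The counts
  -- agree with those for `ν`, where `beta-split` applies; lowering by `s` turns class c + s into
  -- class `c`, so the two counts differ by the contribution of the s-set.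
  a-difference : ∀ c → a t c κ - (a t (c + + s) κ - + s) ≡ + #𝒮 s t ν c * + t
  a-difference c = begin
    a t c κ - (a t (c + + s) κ - + s)
      ≡⟨ cong₂ (λ x y → x - (y - + s))
           (core-a t κ κ-flush (ℕ.≤-trans bκ≤m (ℕ.m≤m+n m s)) -m-s≋c)
           (core-a t κ κ-flush bκ≤m -m≋c+s) ⟩
    - + (m ℕ.+ s) + + #β t c κ (m ℕ.+ s) * + t - (- + m + + N * + t - + s)
      ≡⟨ cong (λ k → - + (m ℕ.+ s) + + k * + t - (- + m + + N * + t - + s)) #β-split ⟩
    - + (m ℕ.+ s) + + (N ℕ.+ #𝒮 s t ν c) * + t - (- + m + + N * + t - + s)
      ≡⟨ identity (+ m) (+ s) (+ t) (+ N) (+ #𝒮 s t ν c) ⟩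
    + #𝒮 s t ν c * + t ∎
    where
    open ≡-Reasoning
    identity : ∀ m s t n k → - (m + s) + (n + k) * t - (- m + n * t - s) ≡ k * t
    identity = solve-∀

    κ-flush : Flush t κ
    κ-flush = core⇒flush t κ (proj₂ ν-κ)

    n₀ = proj₁ (coreOf-#β (proj₁ ν-κ))
    -- The remainder `r` puts -m in the class of c + s, hence -(m + s) in the class of `c`; the
    -- multiple of `t` lifts `m` above `n₀` and both bounds.
    M = n₀ ℕ.+ (bound ν ℕ.+ bound κ)
    r = toℕ (residue t (- (c + + s)))
    m = r ℕ.+ M ℕ.* t

    M≤m : M ℕ.≤ m
    M≤m = ℕ.≤-trans (ℕ.m≤m*n M t) (ℕ.m≤n+m _ r)
    bκ≤m : bound κ ℕ.≤ m
    bκ≤m = ℕ.≤-trans (ℕ.≤-trans (ℕ.m≤n+m (bound κ) (bound ν)) (ℕ.m≤n+m _ n₀)) M≤m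
    bν≤m : bound ν ℕ.≤ m
    bν≤m = ℕ.≤-trans (ℕ.≤-trans (ℕ.m≤m+n (bound ν) (bound κ)) (ℕ.m≤n+m _ n₀)) M≤m
    n₀≤m : n₀ ℕ.≤ m
    n₀≤m = ℕ.≤-trans (ℕ.m≤m+n n₀ _) M≤m

    +m≋ : + m ≋ - (c + + s) [ t ]
    +m≋ = mod-trans (subst (_≋ + r [ t ]) (cong (λ k → + r + k) (sym (ℤ.pos-* M t))) (mod-multiple (+ r) (+ M)))
      (mod-sym (≋-residue t (- (c + + s))))
    -m≋c+s : - + m ≋ c + + s [ t ]
    -m≋c+s = subst (- + m ≋_[ t ]) (ℤ.neg-involutive (c + + s)) (mod-neg +m≋)
    -m-s≋c : - + (m ℕ.+ s) ≋ c [ t ]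
    -m-s≋c = subst₂ (_≋_[ t ]) (identity₁ (+ m) (+ s)) (identity₂ c (+ s)) (mod-+ -m≋c+s (mod-refl {x = - + s}))
      where
      identity₁ : ∀ m s → - m + - s ≡ - (m + s)
      identity₁ = solve-∀
      identity₂ : ∀ c s → c + s + - s ≡ c
      identity₂ = solve-∀

    N = #β t (c + + s) κ m

    #β-split : #β t c κ (m ℕ.+ s) ≡ N ℕ.+ #𝒮 s t ν c
    #β-split = begin
      #β t c κ (m ℕ.+ s)
        ≡⟨ proj₂ (coreOf-#β (proj₁ ν-κ)) (m ℕ.+ s) (ℕ.≤-trans n₀≤m (ℕ.m≤m+n m s)) c ⟩
      #β t c ν (m ℕ.+ s)
        ≡⟨ ↭-length (filter-↭ (_≋? c [ t ]) (beta-split s ν (core⇒flush s ν ν-core) bν≤m)) ⟩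
      count (_≋? c [ t ]) (shifted ++ ends)
        ≡⟨ trans (cong length (filter-++ (_≋? c [ t ]) shifted ends)) (length-++ (filter (_≋? c [ t ]) shifted)) ⟩
      count (_≋? c [ t ]) shifted ℕ.+ #𝒮 s t ν c
        ≡⟨ cong (ℕ._+ #𝒮 s t ν c) (count-applyUpTo-cong (_≋? c [ t ]) (_≋? (c + + s) [ t ]) (λ i → beta ν i - + s) (beta ν)
             (λ i p → subst (_≋ c + + s [ t ]) (x-y+y≡x (beta ν i) (+ s)) (mod-+ p mod-refl))
             (λ i p → subst (beta ν i - + s ≋_[ t ]) (x+y-y≡x c (+ s)) (mod-+ p mod-refl)) m) ⟩
      #β t (c + + s) ν m ℕ.+ #𝒮 s t ν c
        ≡⟨ cong (ℕ._+ #𝒮 s t ν c) (proj₂ (coreOf-#β (proj₁ ν-κ)) m n₀≤m (c + + s)) ⟨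
      N ℕ.+ #𝒮 s t ν c ∎
      where
      shifted = applyUpTo (λ i → beta ν i - + s) m
      ends = tabulate (λ i → σ s ν i - + s)

-- Cardinalities

module _ (S : Setoid 0ℓ 0ℓ) where
  open Setoid S using (Carrier; _≈_; reflexive)

  mkCardinality : ∀ {P : Pred Carrier 0ℓ} {n} (e : Fin n → ∃ P) →
                  (∀ {i j} → proj₁ (e i) ≈ proj₁ (e j) → i ≡ j) →
                  (∀ x → P x → ∃ λ i → proj₁ (e i) ≈ x) →
                  HasCardinality S P n
  mkCardinality e inj surj = record
    { to        = e
    ; cong      = λ i≡j → reflexive (cong (proj₁ ∘ e) i≡j)
    ; bijective = inj , λ (x , px) → proj₁ (surj x px) ,
        λ { refl → proj₂ (surj x px) }
    }

  module _ {P : Pred Carrier 0ℓ} {n} (card : HasCardinality S P n) where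
    elements : Fin n → ∃ P
    elements = Bijection.to card

    elements-injective : ∀ {i j} → proj₁ (elements i) ≈ proj₁ (elements j) → i ≡ j
    elements-injective = Bijection.injective card

    elements-surjective : ∀ x → P x → ∃ λ i → proj₁ (elements i) ≈ x
    elements-surjective x px = Bijection.strictlySurjective card (x , px)

lookup-injective : ∀ {A : Set} {xs : List A} → Unique xs → ∀ {i j} → lookup xs i ≡ lookup xs j → i ≡ j
lookup-injective (_  ∷ _)   {zero}  {zero}  _  = refl
lookup-injective (x∉ ∷ _)   {zero}  {suc j} eq = contradiction eq (All.lookup x∉ (∈-lookup j))
lookup-injective (x∉ ∷ _)   {suc i} {zero}  eq = contradiction (sym eq) (All.lookup x∉ (∈-lookup i))
lookup-injective (_  ∷ xs!) {suc i} {suc j} eq = cong suc (lookup-injective xs! eq)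

list-cardinality : ∀ {A : Set} {P : Pred A 0ℓ} {xs : List A} → Unique xs →
                   (∀ x → x ∈ xs ⇔ P x) → HasCardinality (setoid A) P (length xs)
list-cardinality {A} {xs = xs} xs! ∈⇔P = mkCardinality (setoid A)
  (λ i → lookup xs i , to (∈⇔P _) (∈-lookup i))
  (lookup-injective xs!)
  λ x px → Any.index (from (∈⇔P x) px) , sym (Any.lookup-index (from (∈⇔P x) px))

-- Colour classes

indicator : ∀ {P : Set} → Dec P → ℕ
indicator P? = if does P? then 1 else 0

count-tabulate : ∀ {A : Set} {P : Pred A 0ℓ} (P? : Decidable P) {n} (f : Fin n → A) →
                 count P? (tabulate f) ≡ ∑.sum (λ i → indicator (P? (f i)))
count-tabulate P? {zero}  f = refl
count-tabulate P? {suc n} f with P? (f zero)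
... | yes _ = cong suc (count-tabulate P? (f ∘ suc))
... | no  _ = count-tabulate P? (f ∘ suc)

count-tabulate-cong : ∀ {A B : Set} {P : Pred A 0ℓ} {Q : Pred B 0ℓ} (P? : Decidable P) (Q? : Decidable Q)
                      {n} (f : Fin n → A) (g : Fin n → B) →
                      (∀ i → P (f i) ⇔ Q (g i)) → count P? (tabulate f) ≡ count Q? (tabulate g)
count-tabulate-cong P? Q? {zero}  f g P⇔Q = refl
count-tabulate-cong P? Q? {suc n} f g P⇔Q
  with P? (f zero) | Q? (g zero) | count-tabulate-cong P? Q? (f ∘ suc) (g ∘ suc) (P⇔Q ∘ suc)
... | yes _ | yes _ | eq = cong suc eq
... | no  _ | no  _ | eq = eq
... | yes p | no ¬q | _  = contradiction (to (P⇔Q zero) p) ¬q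
... | no ¬p | yes q | _  = contradiction (from (P⇔Q zero) q) ¬p

module _ {t : ℕ} where

  # : ∀ {n} → (Fin n → Fin t) → Fin t → ℕ
  # χ c = count (_≟ c) (tabulate χ)

  #-remove : ∀ {n} (χ : Fin (suc n) → Fin t) c i → # χ c ≡ indicator (χ i ≟ c) ℕ.+ # (χ ∘ punchIn i) c
  #-remove χ c i = begin
    # χ c                                                             ≡⟨ count-tabulate (_≟ c) χ ⟩
    ∑.sum (λ j → indicator (χ j ≟ c))                                 ≡⟨ ∑.sum-remove {i = i} (λ j → indicator (χ j ≟ c)) ⟩
    indicator (χ i ≟ c) ℕ.+ ∑.sum (λ j → indicator (χ (punchIn i j) ≟ c)) ≡⟨ cong (indicator (χ i ≟ c) ℕ.+_) (count-tabulate (_≟ c) (χ ∘ punchIn i)) ⟨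
    indicator (χ i ≟ c) ℕ.+ # (χ ∘ punchIn i) c                       ∎
    where open ≡-Reasoning

  fibre-cardinality : ∀ {n} (χ : Fin n → Fin t) c → HasCardinality (setoid (Fin n)) (λ i → χ i ≡ c) (# χ c)
  fibre-cardinality {n} χ c = subst (HasCardinality (setoid (Fin n)) (λ i → χ i ≡ c))
    (count-tabulate-cong (λ i → χ i ≟ c) (_≟ c) id χ (λ i → mk⇔ id id))
    (list-cardinality (Unique.filter⁺ (λ i → χ i ≟ c) (Unique.allFin⁺ n))
      λ i → mk⇔ (proj₂ ∘ ∈-filter⁻ (λ i → χ i ≟ c) {xs = allFin n}) (∈-filter⁺ (λ i → χ i ≟ c) (∈-allFin i)))

-- For the induction on coloured permutations: removing a point shrinks one colour class, which
-- changes one factor of the product of factorials.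
∏-scale : ∀ {t} (f g : Fin t → ℕ) c m → f c ≡ m ℕ.* g c → (∀ d → d ≢ c → f d ≡ g d) → ∏ℕ f ≡ m ℕ.* ∏ℕ g
∏-scale {suc t} f g c m fc f≡g = begin
  ∏ℕ f                                        ≡⟨ ∏.sum-remove {i = c} f ⟩
  f c ℕ.* ∏ℕ (f ∘ punchIn c)                  ≡⟨ cong₂ ℕ._*_ fc (∏.sum-cong-≗ (λ d → f≡g (punchIn c d) (punchInᵢ≢i c d))) ⟩
  m ℕ.* g c ℕ.* ∏ℕ (g ∘ punchIn c)            ≡⟨ ℕ.*-assoc m (g c) _ ⟩
  m ℕ.* (g c ℕ.* ∏ℕ (g ∘ punchIn c))          ≡⟨ cong (m ℕ.*_) (∏.sum-remove {i = c} g) ⟨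
  m ℕ.* ∏ℕ g                                  ∎
  where open ≡-Reasoning

-- Colour-preserving permutations

Permutations : ℕ → Setoid 0ℓ 0ℓ
Permutations n = On.setoid (Fin n →-setoid Fin n) _⟨$⟩ʳ_

-- Two colourings, because deleting 0 from the source and its image from the target may leave the
-- remaining points coloured differently.
Coloured : ∀ {t n} (χ χ′ : Fin n → Fin t) → Pred (Permutation′ n) 0ℓ
Coloured χ χ′ π = ∀ i → χ′ (π ⟨$⟩ʳ i) ≡ χ i

module _ {t : ℕ} where

  -- A coloured permutation is the image i of 0, chosen among the points with
  -- the colour of 0, together with a coloured bijection between the other points.
  coloured-suc : ∀ {n N} (χ χ′ : Fin (suc n) → Fin t) →
                 (∀ i → χ′ i ≡ χ zero → HasCardinality (Permutations n) (Coloured (χ ∘ suc) (χ′ ∘ punchIn i)) N) →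
                 HasCardinality (Permutations (suc n)) (Coloured χ χ′) (# χ′ (χ zero) ℕ.* N)
  coloured-suc {n} {N} χ χ′ rest = mkCardinality (Permutations (suc n)) e e-injective e-surjective
    where
    Iₛ = setoid (Fin (suc n))
    Πₛ = Permutations n
    images = fibre-cardinality χ′ (χ zero)

    image : Fin (# χ′ (χ zero)) → Fin (suc n)
    image p = proj₁ (elements Iₛ images p)
    rest′ : ∀ p → HasCardinality Πₛ (Coloured (χ ∘ suc) (χ′ ∘ punchIn (image p))) N
    rest′ p = rest (image p) (proj₂ (elements Iₛ images p))
    π : ∀ p → Fin N → Permutation′ n
    π p q = proj₁ (elements Πₛ (rest′ p) q)

    coloured : ∀ p q → Coloured χ χ′ (insert zero (image p) (π p q))
    coloured p q zero    = proj₂ (elements Iₛ images p)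
    coloured p q (suc j) = trans (cong χ′ (insert-punchIn zero (image p) (π p q) j)) (proj₂ (elements Πₛ (rest′ p) q) j)

    e : Fin (# χ′ (χ zero) ℕ.* N) → ∃ (Coloured χ χ′)
    e x = let p , q = remQuot N x in insert zero (image p) (π p q) , coloured p q

    insert-injective : ∀ p q p′ q′ → Setoid._≈_ (Permutations (suc n)) (insert zero (image p) (π p q)) (insert zero (image p′) (π p′ q′)) →
                       (p , q) ≡ (p′ , q′)
    insert-injective p q p′ q′ eq with elements-injective Iₛ images {p} {p′} (eq zero)
    ... | refl = cong (p ,_) (elements-injective Πₛ (rest′ p) λ j → punchIn-injective (image p) _ _
      (trans (sym (insert-punchIn zero (image p) (π p q) j)) (trans (eq (suc j)) (insert-punchIn zero (image p) (π p q′) j))))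

    e-injective : ∀ {x y} → Setoid._≈_ (Permutations (suc n)) (proj₁ (e x)) (proj₁ (e y)) → x ≡ y
    e-injective {x} {y} eq = trans (sym (combine-remQuot {# χ′ (χ zero)} N x))
      (trans (cong (λ (p , q) → combine p q) (insert-injective _ _ _ _ eq)) (combine-remQuot {# χ′ (χ zero)} N y))

    e-surjective : ∀ ρ → Coloured χ χ′ ρ → ∃ λ x → Setoid._≈_ (Permutations (suc n)) (proj₁ (e x)) ρ
    e-surjective ρ ρ-coloured with elements-surjective Iₛ images (ρ ⟨$⟩ʳ zero) (ρ-coloured zero)
    ... | p , image≡ with elements-surjective Πₛ (rest′ p) (remove zero ρ)
        (λ j → trans (cong χ′ (trans (cong (λ i → punchIn i (remove zero ρ ⟨$⟩ʳ j)) image≡)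
          (trans (sym (insert-punchIn zero (ρ ⟨$⟩ʳ zero) (remove zero ρ) j)) (insert-remove zero ρ (suc j)))))
          (ρ-coloured (suc j)))
    ...   | q , π≡ = combine p q , λ i → trans (cong (λ (p , q) → insert zero (image p) (π p q) ⟨$⟩ʳ i) (remQuot-combine p q)) (agrees i)
      where
      agrees : ∀ i → insert zero (image p) (π p q) ⟨$⟩ʳ i ≡ ρ ⟨$⟩ʳ i
      agrees zero    = image≡
      agrees (suc j) = trans (insert-punchIn zero (image p) (π p q) j) (trans (cong₂ punchIn image≡ (π≡ j))
        (trans (sym (insert-punchIn zero (ρ ⟨$⟩ʳ zero) (remove zero ρ) j)) (insert-remove zero ρ (suc j))))

  -- Induction on `n`: the image of 0 has as many choices as its colour class has points, and fixing
  -- it lowers that class by one in both colourings. The product follows from (m + 1)! = (m + 1) ·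
  -- m!.
  coloured-cardinality : ∀ {n} (χ χ′ : Fin n → Fin t) → (∀ c → # χ c ≡ # χ′ c) →
                         HasCardinality (Permutations n) (Coloured χ χ′) (∏ℕ (λ c → # χ c !))
  coloured-cardinality {zero} χ χ′ _ = subst (HasCardinality (Permutations 0) (Coloured χ χ′)) (sym (∏.sum-replicate-zero t))
    (mkCardinality (Permutations 0) {n = 1} (λ _ → idₚ , λ ()) (λ { {zero} {zero} _ → refl }) λ _ _ → zero , λ ())
  coloured-cardinality {suc n} χ χ′ χ∼χ′ = subst (HasCardinality (Permutations (suc n)) (Coloured χ χ′)) (sym total)
    (coloured-suc χ χ′ λ i χ′i≡χ0 → coloured-cardinality (χ ∘ suc) (χ′ ∘ punchIn i) λ c →
      ℕ.+-cancelˡ-≡ (indicator (χ zero ≟ c)) _ _ (begin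
        indicator (χ zero ≟ c) ℕ.+ # (χ ∘ suc) c          ≡⟨ #-remove χ c zero ⟨
        # χ c                                             ≡⟨ χ∼χ′ c ⟩
        # χ′ c                                            ≡⟨ #-remove χ′ c i ⟩
        indicator (χ′ i ≟ c) ℕ.+ # (χ′ ∘ punchIn i) c     ≡⟨ cong (λ d → indicator (d ≟ c) ℕ.+ # (χ′ ∘ punchIn i) c) χ′i≡χ0 ⟩
        indicator (χ zero ≟ c) ℕ.+ # (χ′ ∘ punchIn i) c   ∎))
    where
    open ≡-Reasoning
    indicator-yes : ∀ {P : Set} (P? : Dec P) → P → indicator P? ≡ 1
    indicator-yes (yes _) _ = refl
    indicator-yes (no ¬p) p = contradiction p ¬p
    indicator-no : ∀ {P : Set} (P? : Dec P) → ¬ P → indicator P? ≡ 0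
    indicator-no (yes p) ¬p = contradiction p ¬p
    indicator-no (no _)  _  = refl

    #-zero : # χ (χ zero) ≡ suc (# (χ ∘ suc) (χ zero))
    #-zero = trans (#-remove χ (χ zero) zero) (cong (ℕ._+ # (χ ∘ suc) (χ zero)) (indicator-yes (χ zero ≟ χ zero) refl))

    total : ∏ℕ (λ c → # χ c !) ≡ # χ′ (χ zero) ℕ.* ∏ℕ (λ c → # (χ ∘ suc) c !)
    total = trans
      (∏-scale (λ c → # χ c !) (λ c → # (χ ∘ suc) c !) (χ zero) (# χ (χ zero))
        (trans (cong _! #-zero) (cong (ℕ._* # (χ ∘ suc) (χ zero) !) (sym #-zero)))
        (λ d d≢ → cong _! (trans (#-remove χ d zero) (cong (ℕ._+ # (χ ∘ suc) d) (indicator-no (χ zero ≟ d) (d≢ ∘ sym))))))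
      (cong (ℕ._* ∏ℕ (λ c → # (χ ∘ suc) c !)) (χ∼χ′ (χ zero)))

-- Pigeonhole: were `i` missed, punching it out of the target would inject `Fin (suc n)` into
-- `Fin n`.
injective⇒permutation : ∀ {n} (f : Fin n → Fin n) → (∀ {i j} → f i ≡ f j → i ≡ j) → ∃ λ (π : Permutation′ n) → ∀ i → π ⟨$⟩ʳ i ≡ f i
injective⇒permutation {n} f f-injective =
  permutation f (proj₁ ∘ preimage) (proj₂ ∘ preimage) (λ j → f-injective (proj₂ (preimage (f j)))) , λ _ → refl
  where
  missed : ∀ {n} (f : Fin n → Fin n) → (∀ {i j} → f i ≡ f j → i ≡ j) → ∀ i → ¬ (∀ j → i ≢ f j)
  missed {suc n} f inj i i∉f = contradiction (injective⇒≤ {f = λ j → punchOut (i∉f j)} (inj ∘ punchOut-injective (i∉f _) (i∉f _))) ℕ.1+n≰n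

  preimage : ∀ i → ∃ λ j → f j ≡ i
  preimage i with any? (λ j → f j ≟ i)
  ... | yes p = p
  ... | no ∄j = contradiction (λ j i≡fj → ∄j (j , sym i≡fj)) (missed f f-injective i)

-- Stabilisers

-- Pascal's rule, with the last summand `n` read as `n C 1`.
∑-toℕ : ∀ n → ∑ℤ {n} (λ i → + toℕ i) ≡ + (n C 2)
∑-toℕ zero    = refl
∑-toℕ (suc n) = begin
  ∑ℤ {suc n} (λ i → + toℕ i)                                    ≡⟨ ∑ᶻ.sum-init-last {n} (λ i → + toℕ i) ⟩
  ∑ℤ {n} (λ i → + toℕ (inject₁ i)) + + toℕ (fromℕ n)            ≡⟨ cong₂ _+_ (∑ᶻ.sum-cong-≗ {n} (λ i → cong +_ (toℕ-inject₁ i))) (cong +_ (toℕ-fromℕ n)) ⟩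
  ∑ℤ {n} (λ i → + toℕ i) + + n                                  ≡⟨ cong (_+ + n) (∑-toℕ n) ⟩
  + (n C 2 ℕ.+ n)                                               ≡⟨ cong +_ (trans (ℕ.+-comm (n C 2) n) (cong (ℕ._+ n C 2) (sym (nC1≡n n)))) ⟩
  + (n C 1 ℕ.+ n C 2)                                           ≡⟨ cong +_ (nCk+nC[k+1]≡[n+1]C[k+1] n 1) ⟩
  + (suc n C 2)                                                 ∎
  where open ≡-Reasoning

-- Periodic extensions of permutations of a transversal

module Extension {s} .{{_ : NonZero s}} (ρ : Fin s → ℤ) (ρ-≋ : ∀ i → ρ i ≋ + toℕ i [ s ]) where

  -- Moves the whole class of `ρ i` modulo `s` by the displacement that takes `ρ i` to `ρ (π i)`.
  extend : (Fin s → Fin s) → ℤ → ℤ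
  extend π m = m + (ρ (π (residue s m)) - ρ (residue s m))

  residue-ρ : ∀ i → residue s (ρ i) ≡ i
  residue-ρ i = residue-unique (ρ-≋ i)

  ≋-ρ-residue : ∀ m → m ≋ ρ (residue s m) [ s ]
  ≋-ρ-residue m = mod-trans (≋-residue s m) (mod-sym (ρ-≋ (residue s m)))

  extend-ρ : ∀ π i → extend π (ρ i) ≡ ρ (π i)
  extend-ρ π i = trans (cong (λ j → ρ i + (ρ (π j) - ρ j)) (residue-ρ i)) (identity (ρ i) (ρ (π i)))
    where
    identity : ∀ x y → x + (y - x) ≡ y
    identity = solve-∀

  residue-extend : ∀ π m → residue s (extend π m) ≡ π (residue s m)
  residue-extend π m = residue-unique (mod-trans
    (subst (extend π m ≋_[ s ]) (identity (ρ i) (ρ (π i))) (mod-+ (≋-ρ-residue m) mod-refl))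
    (ρ-≋ (π i)))
    where
    i = residue s m
    identity : ∀ x y → x + (y - x) ≡ y
    identity = solve-∀

  extend-inverse : ∀ {π π⁻¹} → (∀ i → π⁻¹ (π i) ≡ i) → ∀ m → extend π⁻¹ (extend π m) ≡ m
  extend-inverse {π} {π⁻¹} inv m = begin
    extend π m + (ρ (π⁻¹ (residue s (extend π m))) - ρ (residue s (extend π m)))
      ≡⟨ cong (λ j → extend π m + (ρ (π⁻¹ j) - ρ j)) (residue-extend π m) ⟩
    extend π m + (ρ (π⁻¹ (π i)) - ρ (π i))
      ≡⟨ cong (λ j → extend π m + (ρ j - ρ (π i))) (inv i) ⟩
    m + (ρ (π i) - ρ i) + (ρ i - ρ (π i))
      ≡⟨ identity m (ρ i) (ρ (π i)) ⟩
    m ∎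
    where
    open ≡-Reasoning
    i = residue s m
    identity : ∀ m x y → m + (y - x) + (x - y) ≡ m
    identity = solve-∀

  extend-periodic : ∀ π m → extend π (m + + s) ≡ extend π m + + s
  extend-periodic π m = trans
    (cong (λ j → m + + s + (ρ (π j) - ρ j)) same-residue)
    (identity m (+ s) (ρ (π (residue s m)) - ρ (residue s m)))
    where
    same-residue : residue s (m + + s) ≡ residue s m
    same-residue = residue-cong (mod-shift m)
    identity : ∀ m s d → m + s + d ≡ m + d + s
    identity = solve-∀

  -- The displacements sum to zero because `π` merely permutes the terms of the sum of `ρ`; that sum
  -- is added to both sides to avoid subtraction.
  extend-balanced : ∀ (π : Permutation′ s) → ∑ℤ {s} (λ i → extend (π ⟨$⟩ʳ_) (+ toℕ i)) ≡ + (s C 2)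
  extend-balanced π = trans (+-cancelʳ (∑ℤ {s} ρ) (∑ℤ {s} (λ i → extend πʳ (+ toℕ i))) (∑ℤ {s} (λ i → + toℕ i)) (begin
    ∑ℤ {s} (λ i → extend πʳ (+ toℕ i)) + ∑ℤ {s} ρ       ≡⟨ ∑ᶻ.∑-distrib-+ {s} (λ i → extend πʳ (+ toℕ i)) ρ ⟨
    ∑ℤ {s} (λ i → extend πʳ (+ toℕ i) + ρ i)        ≡⟨ ∑ᶻ.sum-cong-≗ {s} pointwise ⟩
    ∑ℤ {s} (λ i → + toℕ i + ρ (πʳ i))               ≡⟨ ∑ᶻ.∑-distrib-+ {s} (λ i → + toℕ i) (λ i → ρ (πʳ i)) ⟩
    ∑ℤ {s} (λ i → + toℕ i) + ∑ℤ {s} (λ i → ρ (πʳ i)) ≡⟨ cong (λ x → ∑ℤ {s} (λ i → + toℕ i) + x) (∑ᶻ.sum-permute {s} {s} ρ π) ⟨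
    ∑ℤ {s} (λ i → + toℕ i) + ∑ℤ {s} ρ               ∎)) (∑-toℕ s)
    where
    open ≡-Reasoning
    πʳ = π ⟨$⟩ʳ_
    pointwise : ∀ i → extend πʳ (+ toℕ i) + ρ i ≡ + toℕ i + ρ (πʳ i)
    pointwise i = trans
      (cong (λ j → + toℕ i + (ρ (πʳ j) - ρ j) + ρ i) residue-toℕ)
      (identity (+ toℕ i) (ρ (πʳ i)) (ρ i))
      where
      residue-toℕ : residue s (+ toℕ i) ≡ i
      residue-toℕ = residue-unique mod-refl
      identity : ∀ m x y → m + (x - y) + y ≡ m + x
      identity = solve-∀

  extend-congruent : ∀ {t} π → (∀ i → ρ (π i) ≋ ρ i [ t ]) → ∀ m → extend π m ≋ m [ t ]
  extend-congruent {t} π ρπ≋ρ m = subst (extend π m ≋_[ t ]) (identity m (ρ (residue s m)))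
    (mod-+ (mod-refl {x = m}) (mod-+ (ρπ≋ρ (residue s m)) mod-refl))
    where
    identity : ∀ m x → m + (x - x) ≡ m
    identity = solve-∀

  -- For periodic `f` the displacement f m - m depends only on `m` modulo `s`, so it is determined
  -- on the transversal `ρ`.
  extend-unique : ∀ π (f : ℤ → ℤ) → (∀ m → f (m + + s) ≡ f m + + s) → (∀ i → f (ρ i) ≡ ρ (π i)) →
                  ∀ m → extend π m ≡ f m
  extend-unique π f periodic fρ≡ρπ m = begin
    m + (ρ (π i) - ρ i)     ≡⟨ cong (λ x → m + (x - ρ i)) (fρ≡ρπ i) ⟨
    m + (f (ρ i) - ρ i)     ≡⟨ identity m (f (ρ i)) (ρ i) ⟩
    f (ρ i) + m - ρ i       ≡⟨ cong (_- ρ i) (same-shift (≋-ρ-residue m)) ⟨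
    f m + ρ i - ρ i         ≡⟨ x+y-y≡x (f m) (ρ i) ⟩
    f m                     ∎
    where
    open ≡-Reasoning
    i = residue s m
    identity : ∀ m x y → m + (x - y) ≡ x + m - y
    identity = solve-∀

    f-multiple : ∀ x q → f (x + + q * + s) ≡ f x + + q * + s
    f-multiple x zero    = trans (cong f (ℤ.+-identityʳ x)) (sym (ℤ.+-identityʳ (f x)))
    f-multiple x (suc q) = begin
      f (x + + suc q * + s)     ≡⟨ cong f (one-more x (+ q) (+ s)) ⟩
      f (x + + q * + s + + s)   ≡⟨ periodic _ ⟩
      f (x + + q * + s) + + s   ≡⟨ cong (_+ + s) (f-multiple x q) ⟩
      f x + + q * + s + + s     ≡⟨ one-more (f x) (+ q) (+ s) ⟨
      f x + + suc q * + s       ∎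
      where
      one-more : ∀ x q s → x + (+ 1 + q) * s ≡ x + q * s + s
      one-more = solve-∀

    ordered : ∀ {x y} → x ℤ.≤ y → x ≋ y [ s ] → f y + x ≡ f x + y
    ordered {x} x≤y x≋y with ≤≋⇒multiple x≤y x≋y
    ... | q , refl = trans (cong (_+ x) (f-multiple x q)) (swap (f x) (+ q * + s) x)
      where
      swap : ∀ a b c → a + b + c ≡ a + (c + b)
      swap = solve-∀

    same-shift : ∀ {x y} → x ≋ y [ s ] → f x + y ≡ f y + x
    same-shift {x} {y} x≋y with ℤ.≤-total x y
    ... | inj₁ x≤y = sym (ordered x≤y x≋y)
    ... | inj₂ y≤x = ordered y≤x (mod-sym x≋y)

-- Stabiliser elements as coloured permutations

module _ (s t : ℕ) .{{_ : NonZero s}} .{{_ : NonZero t}} (ν : Partition) where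

  private
    ρ : Fin s → ℤ
    ρ = σ s ν

  open Extension ρ (λ i → a-≋ s ν (+ toℕ i))

  -- Taken after lowering by `s`, so that the colour classes are the sets counted by `#𝒮`.
  colour : Fin s → Fin t
  colour i = residue t (ρ i - + s)

  σ∈𝒮 : ∀ i → 𝒮 s ν (ρ i)
  σ∈𝒮 i = + toℕ i , refl

  toG : ∃ (Coloured colour colour) → G s t
  toG (π , π-coloured) = record
    { fun       = extend πʳ
    ; bijective =
        (λ {x} {y} eq → trans (sym (left x)) (trans (cong (extend πˡ) eq) (left y)))
      , λ y → extend πˡ y , λ {x} x≡ → trans (cong (extend πʳ) x≡) (right y)
    ; periodic  = extend-periodic πʳ
    ; balanced  = extend-balanced π
    ; congruent = λ m → unwrap (extend-congruent πʳ ρπ≋ρ m)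
    }
    where
    πʳ πˡ : Fin s → Fin s
    πʳ = π ⟨$⟩ʳ_
    πˡ = π ⟨$⟩ˡ_
    left : ∀ m → extend πˡ (extend πʳ m) ≡ m
    left = extend-inverse {πʳ} {πˡ} (λ i → inverseˡ π {i})
    right : ∀ m → extend πʳ (extend πˡ m) ≡ m
    right = extend-inverse {πˡ} {πʳ} (λ i → inverseʳ π {i})
    ρπ≋ρ : ∀ i → ρ (π ⟨$⟩ʳ i) ≋ ρ i [ t ]
    ρπ≋ρ i = mod-cancel {x = ρ (π ⟨$⟩ʳ i)} {ρ i} (+ s)
      (residue-reflects {x = ρ (π ⟨$⟩ʳ i) - + s} {ρ i - + s} (π-coloured i))

  toG-stabilises : IsCore s ν → ∀ π → Stab s t ν (toG π)
  toG-stabilises ν-core (π , π-coloured) = ν-core , λ x → mk⇔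
    (λ x∈ → ρ (π ⟨$⟩ˡ residue s x) , σ∈𝒮 _ , (begin
      x                                                ≡⟨ 𝒮⇒σ s ν x∈ ⟩
      ρ (residue s x)                                  ≡⟨ cong ρ (inverseʳ π) ⟨
      ρ (π ⟨$⟩ʳ (π ⟨$⟩ˡ residue s x))                   ≡⟨ extend-ρ (π ⟨$⟩ʳ_) (π ⟨$⟩ˡ residue s x) ⟨
      extend (π ⟨$⟩ʳ_) (ρ (π ⟨$⟩ˡ residue s x))         ∎))
    λ (y , y∈ , x≡fy) → subst (𝒮 s ν) (sym (begin
      x                                      ≡⟨ x≡fy ⟩
      extend (π ⟨$⟩ʳ_) y                      ≡⟨ cong (extend (π ⟨$⟩ʳ_)) (𝒮⇒σ s ν y∈) ⟩
      extend (π ⟨$⟩ʳ_) (ρ (residue s y))      ≡⟨ extend-ρ (π ⟨$⟩ʳ_) (residue s y) ⟩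
      ρ (π ⟨$⟩ʳ residue s y)                  ∎)) (σ∈𝒮 _)
    where open ≡-Reasoning

  -- A stabilising `f` maps the s-set onto itself and so permutes its indices; the inverse comes
  -- from the preimages that `IsImage` provides.
  module FromG (f : G s t) (f-stab : Stab s t ν f) where
    f-𝒮 : ∀ x → 𝒮 s ν x ⇔ (∃ λ y → 𝒮 s ν y × x ≡ fun f y)
    f-𝒮 = proj₂ f-stab

    forth back : Fin s → Fin s
    forth i = residue s (fun f (ρ i))
    back  i = residue s (proj₁ (to (f-𝒮 (ρ i)) (σ∈𝒮 i)))

    fρ≡ρ∘forth : ∀ i → fun f (ρ i) ≡ ρ (forth i)
    fρ≡ρ∘forth i = 𝒮⇒σ s ν (from (f-𝒮 (fun f (ρ i))) (ρ i , σ∈𝒮 i , refl))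

    fρ∘back≡ρ : ∀ i → fun f (ρ (back i)) ≡ ρ i
    fρ∘back≡ρ i with to (f-𝒮 (ρ i)) (σ∈𝒮 i)
    ... | y , y∈ , ρi≡fy = trans (cong (fun f) (sym (𝒮⇒σ s ν y∈))) (sym ρi≡fy)

    forth-back : ∀ i → forth (back i) ≡ i
    forth-back i = trans (cong (residue s) (fρ∘back≡ρ i)) (residue-ρ i)

    back-forth : ∀ i → back (forth i) ≡ i
    back-forth i = σ-injective s ν (proj₁ (bijective f) (trans (fρ∘back≡ρ (forth i)) (sym (fρ≡ρ∘forth i))))

    π : Permutation′ s
    π = permutation forth back forth-back back-forth

    π-coloured : Coloured colour colour π
    π-coloured i = residue-cong (mod-+ (subst (_≋ ρ i [ t ]) (fρ≡ρ∘forth i) ⟪ congruent f (ρ i) ⟫) mod-refl)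

  -- `toG` is injective up to pointwise equality because `σ` is injective, and it reaches every
  -- stabiliser element because a periodic map is determined by its values on the s-set.
  stabiliser-cardinality : IsCore s ν → HasCardinality (G-setoid s t) (Stab s t ν) (∏ℕ (λ c → # colour c !))
  stabiliser-cardinality ν-core = mkCardinality (G-setoid s t)
    (λ x → toG (πs x) , toG-stabilises ν-core (πs x))
    (λ {x} {y} eq → elements-injective Πₛ card {x} {y} λ i → σ-injective s ν
      (trans (sym (extend-ρ (proj₁ (πs x) ⟨$⟩ʳ_) i)) (trans (eq (ρ i)) (extend-ρ (proj₁ (πs y) ⟨$⟩ʳ_) i))))
    λ f f-stab → let open FromG f f-stab
                     x , x≈π = elements-surjective Πₛ card π π-coloured
                 in x , extend-unique (proj₁ (πs x) ⟨$⟩ʳ_) (fun f) (periodic f)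
                      λ i → trans (fρ≡ρ∘forth i) (cong ρ (sym (x≈π i)))
    where
    Πₛ = Permutations s
    card = coloured-cardinality colour colour (λ _ → refl)
    πs = elements Πₛ card

-- The quotients and their factorials

-- `_!ᵠ` matches on a literal `mkℚ`, so the normalised fraction has to be brought to that form.
n/1≡ : ∀ n → + n / 1 ≡ mkℚ (+ n) 0 (Coprimality.sym (Coprimality.1-coprimeTo n))
n/1≡ n = ℚ.normalize-coprime (Coprimality.sym (Coprimality.1-coprimeTo n))

n/1!ᵠ : ∀ n → (+ n / 1) !ᵠ ≡ n !
n/1!ᵠ n = cong _!ᵠ (n/1≡ n)

multiple-/ : ∀ n t .{{_ : NonZero t}} → (+ n * + t) / t ≡ + n / 1
multiple-/ n (suc t) = ℚ.fromℚᵘ-cong {mkℚᵘ (+ n * + suc t) t} {mkℚᵘ (+ n) 0} (*≡* (ℤ.*-identityʳ (+ n * + suc t)))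

module _ (s t : ℕ) .{{_ : NonZero s}} .{{_ : NonZero t}} (ν κ : Partition)
         (ν-core : IsCore s ν) (ν-κ : IsCoreOf t ν κ) where

  private
    #S : ℤ → ℕ
    #S = #𝒮 s t ν

  quotient-/ : ∀ c → (a t c κ - (a t (c + + s) κ - + s)) / t ≡ + #S c / 1
  quotient-/ c = trans (ℚ./-cong (a-difference s t ν κ ν-core ν-κ c) refl) (multiple-/ (#S c) t)

  z≡#𝒮 : ∀ j → z s t j κ ≡ + #S (+ s * j + + k s t) / 1
  z≡#𝒮 j = trans (cong (λ i → (a t (+ s * j + + k s t) κ - (a t i κ - + s)) / t) (identity (+ s) j (+ k s t)))
    (quotient-/ (+ s * j + + k s t))
    where
    identity : ∀ s j k → s * (j + + 1) + k ≡ s * j + k + s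
    identity = solve-∀

  𝒮-class-cardinality : ∀ c → HasCardinality (setoid ℤ) (λ x → 𝒮 s ν (x + + s) × x ≡ c [mod t ]) (#S c)
  𝒮-class-cardinality c = list-cardinality
    (Unique.filter⁺ (_≋? c [ t ]) (Unique.tabulate⁺ λ eq → σ-injective s ν (+-cancelʳ (- + s) _ _ eq)))
    λ x → mk⇔ (member x) λ (x+s∈ , x≡c) → ∈-filter⁺ (_≋? c [ t ])
      (subst (_∈ tabulate (λ i → σ s ν i - + s))
        (trans (cong (_- + s) (sym (𝒮⇒σ s ν x+s∈))) (x+y-y≡x x (+ s)))
        (∈-tabulate⁺ (residue s (x + + s))))
      ⟪ x≡c ⟫
    where
    member : ∀ x → x ∈ _ → 𝒮 s ν (x + + s) × x ≡ c [mod t ]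
    member x x∈ with ∈-filter⁻ (_≋? c [ t ]) {xs = tabulate (λ i → σ s ν i - + s)} x∈
    ... | x∈′ , ⟪ x≡c ⟫ with ∈-tabulate⁻ x∈′
    ...   | i , eq = (+ toℕ i , trans (cong (_+ + s) eq) (x-y+y≡x (σ s ν i) (+ s))) , x≡c

  #𝒮≡#colour : ∀ c → #S c ≡ # (colour s t ν) (residue t c)
  #𝒮≡#colour c = count-tabulate-cong (_≋? c [ t ]) (_≟ residue t c) (λ i → σ s ν i - + s) (colour s t ν) λ i → mk⇔ residue-cong residue-reflects

  ∏-quotients : ∏ℕ {t} (λ j → # (colour s t ν) j !) ≡
                ∏ℕ {t} (λ j → ((a t (+ toℕ j) κ - (a t (+ toℕ j + + s) κ - + s)) / t) !ᵠ)
  ∏-quotients = ∏.sum-cong-≗ {t} λ j → sym (begin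
    ((a t (+ toℕ j) κ - (a t (+ toℕ j + + s) κ - + s)) / t) !ᵠ ≡⟨ cong _!ᵠ (quotient-/ (+ toℕ j)) ⟩
    (+ #S (+ toℕ j) / 1) !ᵠ                                     ≡⟨ n/1!ᵠ (#S (+ toℕ j)) ⟩
    #S (+ toℕ j) !                                              ≡⟨ cong _! (#𝒮≡#colour (+ toℕ j)) ⟩
    # (colour s t ν) (residue t (+ toℕ j)) !             ≡⟨ cong (λ c → # (colour s t ν) c !) (residue-unique {t} {+ toℕ j} mod-refl) ⟩
    # (colour s t ν) j !                                 ∎)
    where open ≡-Reasoning

  module _ (s⊥t : Coprime s t) where

    affine : Fin t → Fin t
    affine j = residue t (+ s * + toℕ j + + k s t)

    -- Equal values make `t` divide s(i - j), and `t` is coprime to `s`.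
    affine-injective : ∀ {i j} → affine i ≡ affine j → i ≡ j
    affine-injective {i} {j} eq = mod-toℕ-injective ⟪ ∣ᵤ⇒∣ (coprime-divisor (Coprimality.sym s⊥t)
      (subst (t ℕ.∣_) (trans (cong ∣_∣ (identity (+ s) (+ toℕ i) (+ toℕ j) (+ k s t))) (ℤ.abs-* (+ s) (+ toℕ i - + toℕ j)))
        (∣⇒∣ᵤ (unwrap (residue-reflects {t} eq))))) ⟫
      where
      identity : ∀ s i j k → s * i + k - (s * j + k) ≡ s * (i - j)
      identity = solve-∀

    -- The product over all colours is reindexed along the permutation j ↦ s j + k of the classes
    -- modulo `t`.
    ∏-z : ∏ℕ {t} (λ j → # (colour s t ν) j !) ≡ ∏ℕ {t} (λ j → z s t (+ toℕ j) κ !ᵠ)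
    ∏-z = begin
      ∏ℕ {t} (λ j → # χ j !)                          ≡⟨ ∏.sum-permute (λ j → # χ j !) π ⟩
      ∏ℕ {t} (λ j → # χ (π ⟨$⟩ʳ j) !)                  ≡⟨ ∏.sum-cong-≗ {t} (λ j → sym (step j)) ⟩
      ∏ℕ {t} (λ j → z s t (+ toℕ j) κ !ᵠ)             ∎
      where
      open ≡-Reasoning
      χ = colour s t ν
      affineₚ = injective⇒permutation affine affine-injective
      π = proj₁ affineₚ
      step : ∀ j → z s t (+ toℕ j) κ !ᵠ ≡ # χ (π ⟨$⟩ʳ j) !
      step j = begin
        z s t (+ toℕ j) κ !ᵠ         ≡⟨ cong _!ᵠ (z≡#𝒮 (+ toℕ j)) ⟩
        (+ #S c / 1) !ᵠ              ≡⟨ n/1!ᵠ (#S c) ⟩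
        #S c !                       ≡⟨ cong _! (#𝒮≡#colour c) ⟩
        # χ (affine j) !             ≡⟨ cong (λ c → # χ c !) (proj₂ affineₚ j) ⟨
        # χ (π ⟨$⟩ʳ j) !              ∎
        where c = + s * + toℕ j + + k s t

corollary4p4 : (s t : ℕ) .{{_ : NonZero s}} .{{_ : NonZero t}} → Coprime s t →
    (ν κ : Partition) → IsCore s ν → IsCoreOf t ν κ →
    ((j : ℤ) → ∃ λ n →
    HasCardinality (setoid ℤ)
    (λ x → 𝒮 s ν (x + + s) × x ≡ + s * j + + k s t [mod t ]) n
    × z s t j κ ≡ + n / 1)
    × (∃ λ N →
    HasCardinality (G-setoid s t) (Stab s t ν) N
    × N ≡ ∏ℕ {t} (λ j →
    ((a t (+ toℕ j) κ - (a t (+ toℕ j + + s) κ - + s)) / t) !ᵠ)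
    × N ≡ ∏ℕ {t} (λ j → z s t (+ toℕ j) κ !ᵠ))
corollary4p4 s t s⊥t ν κ ν-core ν-κ =
    -- The witnesses left to inference are `#𝒮` at s j + k and, for the stabiliser, the product of
    -- the factorials of the colour class sizes.
    (λ j → _ , 𝒮-class-cardinality s t ν κ ν-core ν-κ (+ s * j + + k s t) , z≡#𝒮 s t ν κ ν-core ν-κ j)
  , _ , stabiliser-cardinality s t ν ν-core , ∏-quotients s t ν κ ν-core ν-κ , ∏-z s t ν κ ν-core ν-κ s⊥t
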